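{- Let $\mathscr{D}=\{\delta(n): n\in\mathbb{N}, n\ge 1\}\subseteq[0,\infty)$ be the defect set. Then $\mathscr{D}$ is a well-ordered subset of $\mathbb{R}$ (with its usual order) of order type $\omega^\omega$. Furthermore, for every integer $k\ge 1$, the set $\mathscr{D}\cap[0,k)$ has order type $\omega^k$.
   Context: For a positive integer $n$, its complexity $\|n\|$ is the smallest number of $1$'s needed to write $n$ using only the number $1$, addition, multiplication and parentheses (in any legal nesting). The defect of $n$ is $\delta(n)=\|n\|-3\log_3 n$; it is always $\ge 0$. -}

module Defs where

open import Data.Nat using (ℕ; zero; suc; _+_; _*_; _^_; _≤_; _<_; NonZero)
open import Data.Vec using (Vec; []; _∷_)
open import Data.Product using (Σ; ∃; _×_; _,_)
open import Data.Unit using (⊤)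
open import Relation.Binary.PropositionalEquality using (_≡_)
open import Induction.WellFounded using (WellFounded)
open import Function.Bundles using (_⇔_)

data Expr : Set where
  one  : Expr
  _⊕_  : Expr → Expr → Expr
  _⊗_  : Expr → Expr → Expr

eval : Expr → ℕ
eval one       = 1
eval (e ⊕ f)   = eval e + eval f
eval (e ⊗ f)   = eval e * eval f

ones : Expr → ℕ
ones one       = 1
ones (e ⊕ f)   = ones e + ones f
ones (e ⊗ f)   = ones e + ones f

IsComplexity : ℕ → ℕ → Set
IsComplexity n c =
  (Σ Expr λ e → (eval e ≡ n) × (ones e ≡ c)) ×
  (∀ (e : Expr) → eval e ≡ n → c ≤ ones e)

IsComplexityFn : (ℕ → ℕ) → Set
IsComplexityFn cpx = ∀ n → 1 ≤ n → IsComplexity n (cpx n)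

-- Positive integers are indexed by m : ℕ, standing for n = suc m.
-- δ(a) < δ(b)  ⇔  ‖a‖ - 3 log₃ a < ‖b‖ - 3 log₃ b  ⇔  3^‖a‖ · b³ < 3^‖b‖ · a³
DefectLt : (ℕ → ℕ) → ℕ → ℕ → Set
DefectLt cpx i j =
  3 ^ cpx (suc i) * (suc j ^ 3) < 3 ^ cpx (suc j) * (suc i ^ 3)

-- δ(n) < k  ⇔  ‖n‖ < k + 3 log₃ n  ⇔  3^‖n‖ < 3^k · n³
DefectBelow : (ℕ → ℕ) → ℕ → ℕ → Set
DefectBelow cpx k i = 3 ^ cpx (suc i) < 3 ^ k * (suc i ^ 3)

-- Ordinal ω^k: Vec ℕ k of Cantor-normal-form coefficients (most significant
-- first), ordered lexicographically.
data LexLt : ∀ {k} → Vec ℕ k → Vec ℕ k → Set where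
  here  : ∀ {k a b} {v w : Vec ℕ k} → a < b → LexLt (a ∷ v) (b ∷ w)
  there : ∀ {k a} {v w : Vec ℕ k} → LexLt v w → LexLt (a ∷ v) (a ∷ w)

-- Ordinal ω^ω: Cantor normal forms ω^(m-1)·c_(m-1) + … + c_0, c_(m-1) ≠ 0.
LeadingNonZero : ∀ {m} → Vec ℕ m → Set
LeadingNonZero []      = ⊤
LeadingNonZero (c ∷ _) = NonZero c

CNF : Set
CNF = Σ ℕ λ m → Σ (Vec ℕ m) LeadingNonZero

data _<ω_ : CNF → CNF → Set where
  len< : ∀ {m m'} {v : Vec ℕ m} {v' : Vec ℕ m'} {p p'} →
         m < m' → (m , v , p) <ω (m' , v' , p')
  lex< : ∀ {m} {v v' : Vec ℕ m} {p p'} →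
         LexLt v v' → (m , v , p) <ω (m , v' , p')

-- Order isomorphism between the defect values {δ(suc i) : P i} (ordered by
-- DefectLt) and a strictly ordered set (O, _<O_): a map f with
-- δ(a) < δ(b) ⇔ f a <O f b (on P), surjective onto O.
OrderIso : (ℕ → ℕ) → (ℕ → Set) → (O : Set) → (O → O → Set) → Set
OrderIso cpx P O _<O_ =
  Σ (ℕ → O) λ f →
    (∀ i j → P i → P j → (DefectLt cpx i j ⇔ (f i <O f j))) ×
    (∀ (o : O) → ∃ λ i → P i × (f i ≡ o))

AllPos : ℕ → Set
AllPos _ = ⊤

{-# OPTIONS --safe #-}
module Submission where

-- Exponentiating, δ(n) < t becomes 3^‖n‖ / n³ < 3^t. Give every expression e,
-- optimal or not, the value h(e) = 3^ones(e) / eval(e)³ ≥ 1, and let H be the set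
-- of all these values. Multiplying by 1 shows 3H ⊆ H.
--
-- If h(e) < (9/8)^(k+1), then up to a power of 3 and finitely many exceptions e is
-- either a product of two expressions with values below (9/8)^k, or a sum a + b
-- with h(a) < (9/8)^k and b from a finite list. Hence finitely many families,
-- built from constants by products and by f ↦ f · 3ⁿ + b, describe all
-- expressions of bounded value. The value increases with each exponent n, and as
-- n → ∞ it tends to an element of 3H, with a rate uniform in the other exponents.
-- So H is well-ordered, its limit points are exactly 3H, and successors as well
-- as the largest h with 3h ≤ x can be computed.
--
-- With a bottom element adjoined to H, each x is reached from 3h, h = floor x, by
-- finitely many successor steps; the rank of x is ω · rank h plus that number.
-- A successor in H is not in 3H, hence is the value of an optimal expression: only
-- the first element of a block [3h, 3h⁺) can fail to be the value of an integer,
-- so restricting to integers shifts the positions in such a block by at most one.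

open import Defs
open import Data.Empty using (⊥; ⊥-elim)
open import Data.List using (List; []; _∷_; _++_; map; length; filter; cartesianProductWith)
open import Data.List.Membership.Propositional using (_∈_; find; lose)
open import Data.List.Membership.Propositional.Properties
  using (∈-filter⁺; ∈-++⁺ˡ; ∈-++⁺ʳ; ∈-map⁺; ∈-cartesianProductWith⁺)
open import Data.List.Properties using (filter-notAll)
open import Data.List.Relation.Unary.All as All using (All; []; _∷_)
import Data.List.Relation.Unary.All.Properties as All
open import Data.List.Relation.Unary.Any as Any using (Any; here; there; any?)
import Data.List.Relation.Unary.Any.Properties as Any
open import Data.Maybe as Maybe using (Maybe; just; nothing)
open import Data.Nat
open import Data.Nat.Induction using (<-wellFounded)
open import Data.Nat.Properties
open import Data.Nat.Tactic.RingSolver using (solve-∀)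
open import Data.Product using (Σ; ∃; _×_; _,_; proj₁; proj₂)
open import Data.Sum using (_⊎_; inj₁; inj₂; [_,_]′)
open import Data.Unit using (⊤; tt)
open import Data.Vec using (Vec; []; _∷_; _∷ʳ_; initLast; take; drop)
  renaming (_++_ to _++ᵛ_)
open import Function using (_∘_)
open import Function.Bundles using (Equivalence; _⇔_; mk⇔)
open import Induction.WellFounded using (WellFounded; Acc; acc)
open import Relation.Binary.Definitions using (tri<; tri≈; tri>)
open import Relation.Binary.PropositionalEquality
  using (_≡_; refl; sym; trans; cong; cong₂; subst; subst₂; module ≡-Reasoning)
open import Relation.Nullary using (¬_; Dec; yes; no; ¬?)
open import Relation.Nullary.Decidable using (map′; decidable-stable; _×-dec_)

-- Lexicographic order on vectors

LexLt-irrefl : ∀ {k} {v : Vec ℕ k} → ¬ LexLt v v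
LexLt-irrefl (here a<a) = <-irrefl refl a<a
LexLt-irrefl (there v<v) = LexLt-irrefl v<v

LexLt-asym : ∀ {k} {v w : Vec ℕ k} → LexLt v w → ¬ LexLt w v
LexLt-asym (here a<b) (here b<a) = <-asym a<b b<a
LexLt-asym (here a<a) (there _) = <-irrefl refl a<a
LexLt-asym (there _) (here a<a) = <-irrefl refl a<a
LexLt-asym (there v<w) (there w<v) = LexLt-asym v<w w<v

LexLt-∷ʳ-init : ∀ {k a b} {v w : Vec ℕ k} → LexLt v w → LexLt (v ∷ʳ a) (w ∷ʳ b)
LexLt-∷ʳ-init (here a<b) = here a<b
LexLt-∷ʳ-init (there v<w) = there (LexLt-∷ʳ-init v<w)

LexLt-∷ʳ-last : ∀ {k a b} (v : Vec ℕ k) → a < b → LexLt (v ∷ʳ a) (v ∷ʳ b)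
LexLt-∷ʳ-last [] a<b = here a<b
LexLt-∷ʳ-last (_ ∷ v) a<b = there (LexLt-∷ʳ-last v a<b)

LexLt-wellFounded : ∀ k → WellFounded (LexLt {k})
LexLt-wellFounded zero [] = acc λ ()
LexLt-wellFounded (suc k) (a ∷ v) = acc (below (<-wellFounded a) (rec v))
  where
  rec : WellFounded (LexLt {k})
  rec = LexLt-wellFounded k
  below : ∀ {a v w} → Acc _<_ a → Acc (LexLt {k}) v → LexLt w (a ∷ v) → Acc LexLt w
  below (acc r) _ (here b<a) = acc (below (r b<a) (rec _))
  below p (acc s) (there w<v) = acc (below p (s w<v))

-- Total preorders with self-similar limit points

record TotalPreorder (X : Set) : Set₁ where
  infix 4 _≲_ _≺_ _≈_ _≲?_
  field
    _≲_ : X → X → Set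
    ≲-trans : ∀ {x y z} → x ≲ y → y ≲ z → x ≲ z
    ≲-total : ∀ x y → x ≲ y ⊎ y ≲ x
    _≲?_ : ∀ x y → Dec (x ≲ y)

  -- Many expressions share one value, so equality of values is `≈` rather than a quotient.
  -- Strictness is the negated reverse comparison, so a proof of `x ≺ y` may start by assuming
  -- `y ≲ x`.
  _≺_ _≈_ : X → X → Set
  x ≺ y = ¬ (y ≲ x)
  x ≈ y = x ≲ y × y ≲ x

  _≈?_ : ∀ x y → Dec (x ≈ y)
  x ≈? y = (x ≲? y) ×-dec (y ≲? x)

  ≲-refl : ∀ {x} → x ≲ x
  ≲-refl {x} = [ (λ p → p) , (λ p → p) ]′ (≲-total x x)

  ≺⇒≲ : ∀ {x y} → x ≺ y → x ≲ y
  ≺⇒≲ {x} {y} x≺y = [ (λ p → p) , ⊥-elim ∘ x≺y ]′ (≲-total x y)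

  ≈-refl : ∀ {x} → x ≈ x
  ≈-refl = ≲-refl , ≲-refl

  ≈-sym : ∀ {x y} → x ≈ y → y ≈ x
  ≈-sym (p , q) = q , p

  ≈-trans : ∀ {x y z} → x ≈ y → y ≈ z → x ≈ z
  ≈-trans (p , q) (r , s) = ≲-trans p r , ≲-trans s q

  ≺-≲-trans : ∀ {x y z} → x ≺ y → y ≲ z → x ≺ z
  ≺-≲-trans x≺y y≲z z≲x = x≺y (≲-trans y≲z z≲x)

  ≲-≺-trans : ∀ {x y z} → x ≲ y → y ≺ z → x ≺ z
  ≲-≺-trans x≲y y≺z z≲x = y≺z (≲-trans z≲x x≲y)

  ≺-or-≈ : ∀ {x y} → x ≲ y → x ≺ y ⊎ x ≈ y
  ≺-or-≈ {x} {y} x≲y with y ≲? x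
  ... | yes y≲x = inj₂ (x≲y , y≲x)
  ... | no x≺y = inj₁ x≺y

-- The limit points are exactly the non-bottom values of T: `floor x` is the
-- T-preimage of the last limit point below x, and only finitely many classes
-- separate that limit point from x.
record LimitOrder {X : Set} (P : TotalPreorder X) : Set where
  open TotalPreorder P
  field
    bottom : X
    bottom-least : ∀ x → bottom ≲ x

    T : X → X
    T-mono : ∀ {x y} → x ≲ y → T x ≲ T y
    T-cancel : ∀ {x y} → T x ≲ T y → x ≲ y
    T-bottom : T bottom ≲ bottom

    unit : X
    bottom≺unit : bottom ≺ unit
    below-unit : ∀ {x} → x ≺ unit → x ≲ bottom

    succ : X → X
    x≺succ : ∀ x → x ≺ succ x
    succ-least : ∀ {x y} → x ≺ y → succ x ≲ y

    T-limit : ∀ {y h} → y ≺ T h → ∃ λ z → y ≺ z × z ≺ T h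

    floor : X → X
    T-floor : ∀ x → T (floor x) ≲ x
    floor-greatest : ∀ {h x} → T h ≲ x → h ≲ floor x

    finite : ∀ x → Σ (List X) λ L → ∀ y → T (floor x) ≲ y → y ≲ x → Any (y ≈_) L

-- Successors, floors and ranks below the powers of ω

module Rank {X : Set} {P : TotalPreorder X} (S : LimitOrder P) where
  open TotalPreorder P
  open LimitOrder S

  succ-mono : ∀ {x y} → x ≲ y → succ x ≲ succ y
  succ-mono {y = y} x≲y = succ-least (≲-≺-trans x≲y (x≺succ y))

  -- A limit point at `succ x` would have elements approaching it from above `x`, but nothing lies
  -- strictly between `x` and `succ x`.
  succ-isolated : ∀ x h → ¬ (succ x ≈ T h)
  succ-isolated x h (p , q) with T-limit (≺-≲-trans (x≺succ x) p)
  ... | z , x≺z , z≺Th = z≺Th (≲-trans q (succ-least x≺z))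

  floor-mono : ∀ {x y} → x ≲ y → floor x ≲ floor y
  floor-mono {x} x≲y = floor-greatest (≲-trans (T-floor x) x≲y)

  floor-cong : ∀ {x y} → x ≈ y → floor x ≈ floor y
  floor-cong (p , q) = floor-mono p , floor-mono q

  floor-T : ∀ p → floor (T p) ≈ p
  floor-T p = T-cancel (T-floor (T p)) , floor-greatest ≲-refl

  -- If the floor jumped, `T (floor (succ x))` would be a limit point above `x` and at most
  -- `succ x`; `T-limit` then gives an element strictly between the two.
  floor-succ : ∀ x → floor (succ x) ≈ floor x
  floor-succ x = decidable-stable (_ ≲? _) ¬≺ , floor-mono (≺⇒≲ (x≺succ x))
    where
    ¬≺ : ¬ (floor x ≺ floor (succ x))
    ¬≺ p≺h with T-limit {x} {floor (succ x)} (p≺h ∘ floor-greatest)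
    ... | z , x≺z , z≺Th = z≺Th (≲-trans (T-floor (succ x)) (succ-least x≺z))

  floor-bottom : floor bottom ≈ bottom
  floor-bottom = T-cancel (≲-trans (T-floor bottom) (bottom-least _)) , bottom-least _

  succⁿ : ℕ → X → X
  succⁿ zero x = x
  succⁿ (suc n) x = succ (succⁿ n x)

  succⁿ-succ : ∀ n x → succⁿ n (succ x) ≡ succ (succⁿ n x)
  succⁿ-succ zero x = refl
  succⁿ-succ (suc n) x = cong succ (succⁿ-succ n x)

  succⁿ-mono : ∀ n {x y} → x ≲ y → succⁿ n x ≲ succⁿ n y
  succⁿ-mono zero x≲y = x≲y
  succⁿ-mono (suc n) x≲y = succ-mono (succⁿ-mono n x≲y)

  succⁿ-< : ∀ {m n} x → m < n → succⁿ m x ≺ succⁿ n x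
  succⁿ-< {m} {suc n} x m<n with m≤n⇒m<n∨m≡n (s≤s⁻¹ m<n)
  ... | inj₁ m<n′ = ≺-≲-trans (succⁿ-< x m<n′) (≺⇒≲ (x≺succ _))
  ... | inj₂ refl = x≺succ _

  succⁿ-reflects-< : ∀ {m n} x → succⁿ m x ≺ succⁿ n x → m < n
  succⁿ-reflects-< {m} {n} x lt with <-cmp m n
  ... | tri< m<n _ _ = m<n
  ... | tri≈ _ refl _ = ⊥-elim (lt ≲-refl)
  ... | tri> _ _ n<m = ⊥-elim (lt (≺⇒≲ (succⁿ-< x n<m)))

  succⁿ-injective : ∀ {m n} x → succⁿ m x ≈ succⁿ n x → m ≡ n
  succⁿ-injective {m} {n} x (p , q) with <-cmp m n
  ... | tri< m<n _ _ = ⊥-elim (succⁿ-< x m<n q)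
  ... | tri≈ _ m≡n _ = m≡n
  ... | tri> _ _ n<m = ⊥-elim (succⁿ-< x n<m p)

  floor-succⁿ : ∀ n p → floor (succⁿ n (T p)) ≈ p
  floor-succⁿ zero p = floor-T p
  floor-succⁿ (suc n) p = ≈-trans (floor-succ _) (floor-succⁿ n p)

  -- `L` covers all classes above `b` up to `x`. Stepping to `succ b` removes at least the entry
  -- equivalent to it, so the walk ends after at most `length L` steps; `fuel` bounds that length.
  succⁿ-reaches : ∀ fuel (L : List X) {b x} → length L ≤ fuel → b ≲ x →
    (∀ y → b ≺ y → y ≲ x → Any (y ≈_) L) → ∃ λ n → succⁿ n b ≈ x
  succⁿ-reaches fuel L len b≲x cov with ≺-or-≈ b≲x
  ... | inj₂ b≈x = 0 , b≈x
  succⁿ-reaches fuel L {b} {x} len b≲x cov | inj₁ b≺x =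
    step fuel len
    where
    sb≲x : succ b ≲ x
    sb≲x = succ-least b≺x
    hit : Any (succ b ≈_) L
    hit = cov (succ b) (x≺succ b) sb≲x
    above? : ∀ y → Dec (succ b ≺ y)
    above? y = ¬? (y ≲? succ b)
    L′ : List X
    L′ = filter above? L
    shorter : length L′ < length L
    shorter = filter-notAll above? L (Any.map (λ p ¬p → ¬p (proj₂ p)) hit)
    cov′ : ∀ y → succ b ≺ y → y ≲ x → Any (y ≈_) L′
    cov′ y sb≺y y≲x with find (cov y (≲-≺-trans (≺⇒≲ (x≺succ b)) sb≺y) y≲x)
    ... | f , f∈L , y≈f =
      lose (∈-filter⁺ above? f∈L (≺-≲-trans sb≺y (proj₁ y≈f))) y≈f
    step : ∀ fuel → length L ≤ fuel → ∃ λ n → succⁿ n b ≈ x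
    step zero len with () ← ≤-trans shorter len
    step (suc fuel) len
      with n , eq ← succⁿ-reaches fuel L′ (s≤s⁻¹ (≤-trans shorter len)) sb≲x cov′
      = suc n , subst (_≈ x) (succⁿ-succ n b) eq

  position : ∀ x → ∃ λ n → succⁿ n (T (floor x)) ≈ x
  position x with finite x
  ... | L , cov = succⁿ-reaches (length L) L ≤-refl (T-floor x) (λ y → cov y ∘ ≺⇒≲)

  index : X → ℕ
  index x = proj₁ (position x)

  at-index : ∀ {x p} → floor x ≈ p → succⁿ (index x) (T p) ≈ x
  at-index {x} {p} (q , r) with position x
  ... | n , (s , t) =
    ≲-trans (succⁿ-mono n (T-mono r)) s , ≲-trans t (succⁿ-mono n (T-mono q))

  index-unique : ∀ {x p n} → floor x ≈ p → succⁿ n (T p) ≈ x → index x ≡ n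
  index-unique {x} {p} px≈p eq =
    succⁿ-injective (T p) (≈-trans (at-index px≈p) (≈-sym eq))

  index-succⁿ : ∀ n p → index (succⁿ n (T p)) ≡ n
  index-succⁿ n p = index-unique (floor-succⁿ n p) ≈-refl

  index-cong : ∀ {x y} → x ≈ y → index x ≡ index y
  index-cong {x} {y} x≈y =
    index-unique (floor-cong x≈y) (≈-trans (at-index ≈-refl) (≈-sym x≈y))

  index-mono : ∀ {x y} → floor x ≈ floor y → x ≺ y → index x < index y
  index-mono {x} {y} px≈py x≺y = succⁿ-reflects-< (T (floor y))
    (≲-≺-trans (proj₁ (at-index px≈py))
      (≺-≲-trans x≺y (proj₂ (at-index {y} ≈-refl))))

  -- `tower k` will bound the elements of rank below ω^k: each floor lowers the exponent by one
  -- until only `bottom` lies below `unit`.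
  tower : ℕ → X
  tower zero = unit
  tower (suc k) = T (tower k)

  Below : ℕ → X → Set
  Below k x = x ≺ tower k

  Below-floor : ∀ k {x} → Below (suc k) x → Below k (floor x)
  Below-floor k {x} b t≲p = b (≲-trans (T-mono t≲p) (T-floor x))

  Below-floor⁻ : ∀ k {x} → Below k (floor x) → Below (suc k) x
  Below-floor⁻ k b Tt≲x = b (floor-greatest Tt≲x)

  Below-≲ : ∀ k {x y} → x ≲ y → Below k y → Below k x
  Below-≲ k = ≲-≺-trans

  -- Since rank x = ω · rank (floor x) + index x, the index is the least significant digit and goes
  -- to the end of the vector.
  rank : ∀ k → X → Vec ℕ k
  rank zero x = []
  rank (suc k) x = rank k (floor x) ∷ʳ index x

  rank-cong : ∀ k {x y} → x ≈ y → rank k x ≡ rank k y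
  rank-cong zero x≈y = refl
  rank-cong (suc k) x≈y = cong₂ _∷ʳ_ (rank-cong k (floor-cong x≈y)) (index-cong x≈y)

  -- The floors decide first; with equivalent floors both elements lie in one block and their
  -- positions decide.
  rank-mono : ∀ k {x y} → Below k y → x ≺ y → LexLt (rank k x) (rank k y)
  rank-mono zero {x} b x≺y = ⊥-elim (x≺y (≲-trans (below-unit b) (bottom-least x)))
  rank-mono (suc k) {x} {y} b x≺y with ≺-or-≈ (floor-mono (≺⇒≲ x≺y))
  ... | inj₁ p≺ = LexLt-∷ʳ-init (rank-mono k (Below-floor k b) p≺)
  ... | inj₂ p≈ rewrite rank-cong k p≈ = LexLt-∷ʳ-last _ (index-mono p≈ x≺y)

  rank-surjective : ∀ k (v : Vec ℕ k) → ∃ λ x → Below k x × rank k x ≡ v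
  rank-surjective zero [] = bottom , bottom≺unit , refl
  rank-surjective (suc k) v with initLast v
  ... | (w , n , refl) with rank-surjective k w
  ...   | p , b , refl = succⁿ n (T p) ,
      Below-floor⁻ k (Below-≲ k (proj₁ (floor-succⁿ n p)) b) ,
      cong₂ _∷ʳ_ (rank-cong k (floor-succⁿ n p)) (index-succⁿ n p)

  -- Taking `k` floors sends everything below `tower k` to `bottom`, the first element of its own
  -- block, so the extra leading digit is 0.
  rank-suc : ∀ k {x} → Below k x → rank (suc k) x ≡ 0 ∷ rank k x
  rank-suc zero {x} b = cong (_∷ [])
    (index-unique {n = 0} (≈-trans (floor-cong x≈⊥) floor-bottom)
      (≲-trans T-bottom (bottom-least x) , ≲-trans (proj₁ x≈⊥) (bottom-least _)))
    where
    x≈⊥ : x ≈ bottom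
    x≈⊥ = below-unit b , bottom-least x
  rank-suc (suc k) {x} b = cong (_∷ʳ index x) (rank-suc k (Below-floor k b))

  -- Ranks within a subset that may omit limit points

  module Restricted {I : Set} (o : I → X)
    (bottom≺o : ∀ i → bottom ≺ o i)
    (isolated∈o : ∀ x → bottom ≺ x → (∀ h → ¬ (x ≈ T h)) → ∃ λ i → o i ≈ x)
    (T∈o? : ∀ p → Dec (∃ λ i → o i ≈ T p))
    where

    -- Corrects a position in the block of `p`: if its first element `T p` is missing from the
    -- subset, all later positions move down by one.
    shift : ∀ {A : Set} → Dec A → ℕ → ℕ
    shift (yes _) n = n
    shift (no _) n = pred n

    shift-cong : ∀ {A B : Set} (a : Dec A) (b : Dec B) → (A → B) → (B → A) →
      ∀ n → shift a n ≡ shift b n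
    shift-cong (yes _) (yes _) f g n = refl
    shift-cong (yes a) (no ¬b) f g n = ⊥-elim (¬b (f a))
    shift-cong (no ¬a) (yes b) f g n = ⊥-elim (¬a (g b))
    shift-cong (no _) (no _) f g n = refl

    T-transport : ∀ {p q} → p ≈ q → (∃ λ i → o i ≈ T p) → ∃ λ i → o i ≈ T q
    T-transport (p≲q , q≲p) (i , eq) = i , ≈-trans eq (T-mono p≲q , T-mono q≲p)

    shift-T∈o : ∀ {p q} → p ≈ q → ∀ n → shift (T∈o? p) n ≡ shift (T∈o? q) n
    shift-T∈o {p} {q} p≈q =
      shift-cong (T∈o? p) (T∈o? q) (T-transport p≈q) (T-transport (≈-sym p≈q))

    index≢0 : ∀ {p} → ¬ (∃ λ i → o i ≈ T p) → ∀ i → floor (o i) ≈ p → ¬ index (o i) ≡ 0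
    index≢0 {p} T∉o i eq ix≡0 =
      T∉o (i , ≈-sym (subst (λ n → succⁿ n (T p) ≈ o i) ix≡0 (at-index eq)))

    indexₒ : I → ℕ
    indexₒ i = shift (T∈o? (floor (o i))) (index (o i))

    indexₒ-at : ∀ {p} i → floor (o i) ≈ p → indexₒ i ≡ shift (T∈o? p) (index (o i))
    indexₒ-at i eq = shift-T∈o eq (index (o i))

    indexₒ-mono : ∀ {i j} → floor (o i) ≈ floor (o j) → o i ≺ o j → indexₒ i < indexₒ j
    indexₒ-mono {i} {j} eq lt = subst (_< indexₒ j) (sym (indexₒ-at i eq))
      (shift-< (T∈o? (floor (o j))) (index-mono eq lt))
      where
      shift-< : (d : Dec (∃ λ l → o l ≈ T (floor (o j)))) →
        index (o i) < index (o j) → shift d (index (o i)) < shift d (index (o j))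
      shift-< (yes _) lt = lt
      -- `pred` preserves strictness only because the smaller index is nonzero: index 0 would put
      -- `o i` at the missing first element.
      shift-< (no T∉o) lt = pred-mono-< {{>-nonZero (n≢0⇒n>0 (index≢0 T∉o i eq))}} lt

    -- Only the last digit needs correction. Every block contains successors, which lie in the
    -- subset, so no block disappears and the higher digits may be computed in all of `X`.
    rankₒ : ∀ k → I → Vec ℕ (suc k)
    rankₒ k i = rank k (floor (o i)) ∷ʳ indexₒ i

    rankₒ-cong : ∀ k {i j} → o i ≈ o j → rankₒ k i ≡ rankₒ k j
    rankₒ-cong k {i} {j} eq = cong₂ _∷ʳ_ (rank-cong k (floor-cong eq))
      (trans (indexₒ-at i (floor-cong eq))
        (cong (shift (T∈o? (floor (o j)))) (index-cong eq)))

    rankₒ-mono : ∀ k {i j} → Below (suc k) (o j) → o i ≺ o j →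
      LexLt (rankₒ k i) (rankₒ k j)
    rankₒ-mono k {i} {j} b lt with ≺-or-≈ (floor-mono (≺⇒≲ lt))
    ... | inj₁ p≺ = LexLt-∷ʳ-init (rank-mono k (Below-floor k b) p≺)
    ... | inj₂ p≈ rewrite rank-cong k p≈ = LexLt-∷ʳ-last _ (indexₒ-mono p≈ lt)

    rankₒ-reflects : ∀ k {i j} → Below (suc k) (o i) →
      LexLt (rankₒ k i) (rankₒ k j) → o i ≺ o j
    rankₒ-reflects k {i} {j} b lt oj≲oi with ≺-or-≈ oj≲oi
    ... | inj₁ oj≺oi = LexLt-asym lt (rankₒ-mono k b oj≺oi)
    ... | inj₂ oj≈oi = LexLt-irrefl (subst (LexLt _) (rankₒ-cong k oj≈oi) lt)

    at-succ : ∀ n p → ∃ λ i → o i ≈ succⁿ (suc n) (T p)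
    at-succ n p = isolated∈o _ (≲-≺-trans (bottom-least _) (x≺succ _)) (succ-isolated _)

    -- Position `n` in the thinned block is position `n` or `suc n` in the full one, depending on
    -- whether `T p` is present; positive positions are successors and therefore always occupied.
    at-shift : ∀ n p → ∃ λ i → ∃ λ m → o i ≈ succⁿ m (T p) × shift (T∈o? p) m ≡ n
    at-shift n p with T∈o? p
    at-shift zero p | yes (i , eq) = i , 0 , eq , refl
    at-shift (suc n) p | yes _ with i , eq ← at-succ n p = i , suc n , eq , refl
    at-shift n p | no _ with i , eq ← at-succ n p = i , suc n , eq , refl

    rankₒ-surjective : ∀ k (v : Vec ℕ (suc k)) →
      ∃ λ i → Below (suc k) (o i) × rankₒ k i ≡ v
    rankₒ-surjective k v with initLast v
    ... | w , n , refl with rank-surjective k w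
    ...   | p , b , refl with at-shift n p
    ...     | i , m , eq , refl = i , Below-floor⁻ k (Below-≲ k (proj₁ floor≈p) b) ,
      cong₂ _∷ʳ_ (rank-cong k floor≈p)
        (trans (indexₒ-at i floor≈p)
          (cong (shift (T∈o? p)) (index-unique floor≈p (≈-sym eq))))
      where
      floor≈p : floor (o i) ≈ p
      floor≈p = ≈-trans (floor-cong eq) (floor-succⁿ m p)

    rankₒ-suc : ∀ k {i} → Below (suc k) (o i) → rankₒ (suc k) i ≡ 0 ∷ rankₒ k i
    rankₒ-suc k {i} b = cong (_∷ʳ indexₒ i) (rank-suc k (Below-floor k b))

-- Positive fractions and the values 3^ones / eval³

^-distribʳ-* : ∀ k m n → (m * n) ^ k ≡ m ^ k * n ^ k
^-distribʳ-* zero m n = refl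
^-distribʳ-* (suc k) m n = trans (cong (m * n *_) (^-distribʳ-* k m n))
  ([m*n]*[o*p]≡[m*o]*[n*p] m n (m ^ k) (n ^ k))

record Frac : Set where
  no-eta-equality
  pattern
  constructor _//_
  field
    num den : ℕ
    .{{den≢0}} : NonZero den
open Frac

infix 7 _//_
infix 4 _⊑_

-- A record instead of a bare inequality of products, so that both fractions can be recovered from
-- the type.
record _⊑_ (x y : Frac) : Set where
  constructor cross
  field uncross : num x * den y ≤ num y * den x
open _⊑_

fracOrder : TotalPreorder Frac
fracOrder = record
  { _≲_ = _⊑_
  ; ≲-trans = λ {x} {y} {z} → ⊑-trans x y z
  ; ≲-total = λ x y → [ inj₁ ∘ cross , inj₂ ∘ cross ]′ (≤-total (num x * den y) (num y * den x))
  ; _≲?_ = λ x y → map′ cross uncross (num x * den y ≤? num y * den x)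
  }
  where
  swap₂₃ : ∀ a b c → a * b * c ≡ a * c * b
  swap₂₃ = solve-∀
  ⊑-trans : ∀ x y z → x ⊑ y → y ⊑ z → x ⊑ z
  ⊑-trans x y@(_ // _) z (cross p) (cross q) = cross (*-cancelʳ-≤ _ _ (den y) (begin
    num x * den z * den y  ≡⟨ swap₂₃ (num x) _ _ ⟩
    num x * den y * den z  ≤⟨ *-monoˡ-≤ (den z) p ⟩
    num y * den x * den z  ≡⟨ swap₂₃ (num y) _ _ ⟩
    num y * den z * den x  ≤⟨ *-monoˡ-≤ (den x) q ⟩
    num z * den y * den x  ≡⟨ swap₂₃ (num z) _ _ ⟩
    num z * den x * den y  ∎))
    where open ≤-Reasoning

open TotalPreorder fracOrder public

≺-cross : ∀ {x y} → num x * den y < num y * den x → x ≺ y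
≺-cross p (cross q) = <⇒≱ p q

≺-uncross : ∀ {x y} → x ≺ y → num x * den y < num y * den x
≺-uncross x≺y = ≰⇒> (x≺y ∘ cross)

≈-cross : ∀ {x y} → num x * den y ≡ num y * den x → x ≈ y
≈-cross eq = cross (≤-reflexive eq) , cross (≤-reflexive (sym eq))

infixl 6 _⊛_

_⊛_ : Frac → Frac → Frac
(a // b) ⊛ (c // d) = (a * c) // (b * d)
  where instance _ = m*n≢0 b d

⊛-monoˡ : ∀ {x y} z → x ⊑ y → x ⊛ z ⊑ y ⊛ z
⊛-monoˡ {a // b} {c // d} (e // f) (cross p) = cross (subst₂ _≤_
  (sym ([m*n]*[o*p]≡[m*o]*[n*p] a e d f)) (sym ([m*n]*[o*p]≡[m*o]*[n*p] c e b f))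
  (*-monoˡ-≤ (e * f) p))

⊛-cancelʳ : ∀ {x y} z → .{{NonZero (num z)}} → x ⊛ z ⊑ y ⊛ z → x ⊑ y
⊛-cancelʳ {a // b} {c // d} (e // f) (cross p) = cross (*-cancelʳ-≤ (a * d) (c * b) (e * f)
  (subst₂ _≤_ ([m*n]*[o*p]≡[m*o]*[n*p] a e d f) ([m*n]*[o*p]≡[m*o]*[n*p] c e b f) p))
  where instance _ = m*n≢0 e f

⊛-congˡ : ∀ {x y} z → x ≈ y → x ⊛ z ≈ y ⊛ z
⊛-congˡ z (p , q) = ⊛-monoˡ z p , ⊛-monoˡ z q

⊛-comm : ∀ x y → x ⊛ y ≈ y ⊛ x
⊛-comm (a // b) (c // d) = ≈-cross (cong₂ _*_ (*-comm a c) (*-comm d b))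

⊛-assoc : ∀ x y z → (x ⊛ y) ⊛ z ≈ x ⊛ (y ⊛ z)
⊛-assoc (a // b) (c // d) (e // f) =
  ≈-cross (cong₂ _*_ (*-assoc a c e) (sym (*-assoc b d f)))

⊛-congʳ : ∀ x {y z} → y ≈ z → x ⊛ y ≈ x ⊛ z
⊛-congʳ x {y} {z} y≈z = ≈-trans (⊛-comm x y) (≈-trans (⊛-congˡ x y≈z) (⊛-comm z x))

⊛-swap : ∀ x y z → x ⊛ y ⊛ z ≈ x ⊛ z ⊛ y
⊛-swap x y z =
  ≈-trans (⊛-assoc x y z) (≈-trans (⊛-congʳ x (⊛-comm y z)) (≈-sym (⊛-assoc x z y)))

⊛-identityʳ : ∀ n .{{_ : NonZero n}} x → x ⊛ n // n ≈ x
⊛-identityʳ n (a // b) = ≈-cross (lem a b n)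
  where
  lem : ∀ a b n → a * n * b ≡ a * (b * n)
  lem = solve-∀

-- `triple` is the effect of `T` on values; `third` transports a threshold on limits `triple x` to a
-- threshold on `x`.
third triple : Frac → Frac
third x = x ⊛ 1 // 3
triple x = x ⊛ 3 // 1

⊑third⇒triple⊑ : ∀ {x y} → x ⊑ third y → triple x ⊑ y
⊑third⇒triple⊑ {a // b} {c // d} (cross p) =
  cross (subst₂ _≤_ (lem₁ a d) (lem₂ c b) p)
  where
  lem₁ : ∀ a d → a * (d * 3) ≡ a * 3 * d
  lem₁ = solve-∀
  lem₂ : ∀ c b → c * 1 * b ≡ c * (b * 1)
  lem₂ = solve-∀

triple⊑⇒⊑third : ∀ {x y} → triple x ⊑ y → x ⊑ third y
triple⊑⇒⊑third {a // b} {c // d} (cross p) =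
  cross (subst₂ _≤_ (lem₁ a d) (lem₂ c b) p)
  where
  lem₁ : ∀ a d → a * 3 * d ≡ a * (d * 3)
  lem₁ = solve-∀
  lem₂ : ∀ c b → c * (b * 1) ≡ c * 1 * b
  lem₂ = solve-∀

3^≢0 : ∀ n → NonZero (3 ^ n)
3^≢0 n = m^n≢0 3 n

eval≢0 : ∀ e → NonZero (eval e)
eval≢0 one = _
eval≢0 (e ⊕ f) = >-nonZero (≤-trans (>-nonZero⁻¹ (eval e)) (m≤m+n (eval e) (eval f)))
  where instance _ = eval≢0 e
eval≢0 (e ⊗ f) = m*n≢0 (eval e) (eval f)
  where instance _ = eval≢0 e ; _ = eval≢0 f

-- For an optimal expression of n this is 3^δ(n).
fr : Expr → Frac
fr e = 3 ^ ones e // (eval e ^ 3)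
  where instance _ = m^n≢0 (eval e) 3 {{eval≢0 e}}

fr-⊗ : ∀ e f → fr (e ⊗ f) ≈ fr e ⊛ fr f
fr-⊗ e f = ≈-cross (cong₂ _*_ (^-distribˡ-+-* 3 (ones e) (ones f))
  (sym (^-distribʳ-* 3 (eval e) (eval f))))

ratio : (m n : ℕ) → .{{NonZero n}} → Frac
ratio m n = m ^ 3 // (n ^ 3)
  where instance _ = m^n≢0 n 3

powerOf3 : ℕ → Frac
powerOf3 c = 3 ^ c // 1

+≢0 : ∀ m n → .{{NonZero m}} → NonZero (m + n)
+≢0 m n = >-nonZero (≤-trans (>-nonZero⁻¹ m) (m≤m+n m n))

-- The factor (1 + B / 3ⁿ)³, which bounds the relative error caused by a summand B next to a number
-- that is at least 3ⁿ.
stretch : ℕ → ℕ → Frac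
stretch n B = ratio (3 ^ n + B) (3 ^ n) {{3^≢0 n}}

-- All estimates on sums start here: adding `b` multiplies the value by the cost of `b` and divides
-- it by a factor that tends to 1 as `eval a` grows.
fr-⊕ : ∀ a b → fr (a ⊕ b) ⊛ ratio (eval a + eval b) (eval a) {{eval≢0 a}}
  ≈ fr a ⊛ powerOf3 (ones b)
fr-⊕ a b rewrite ^-distribˡ-+-* 3 (ones a) (ones b) =
  ≈-cross (lem (3 ^ ones a * 3 ^ ones b) ((eval a + eval b) ^ 3) (eval a ^ 3))
  where
  lem : ∀ p s v → p * s * (v * 1) ≡ p * (s * v)
  lem = solve-∀

⊛-monoʳ : ∀ x {y z} → y ⊑ z → x ⊛ y ⊑ x ⊛ z
⊛-monoʳ x {y} {z} y⊑z = ≲-trans (proj₁ (⊛-comm x y))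
  (≲-trans (⊛-monoˡ x y⊑z) (proj₁ (⊛-comm z x)))

ratio-anti : ∀ m n B → .{{_ : NonZero m}} → .{{_ : NonZero n}} → m ≤ n →
  ratio (n + B) n ⊑ ratio (m + B) m
ratio-anti m n B m≤n = cross (subst₂ _≤_
  (^-distribʳ-* 3 (n + B) m) (^-distribʳ-* 3 (m + B) n) (^-monoˡ-≤ 3 le))
  where
  le : (n + B) * m ≤ (m + B) * n
  le = begin
    (n + B) * m    ≡⟨ *-distribʳ-+ m n B ⟩
    n * m + B * m  ≤⟨ +-mono-≤ (≤-reflexive (*-comm n m)) (*-monoʳ-≤ B m≤n) ⟩
    m * n + B * n  ≡⟨ *-distribʳ-+ n m B ⟨
    (m + B) * n    ∎
    where open ≤-Reasoning

-- A larger `eval a` shrinks the factor divided out in `fr-⊕`, so value and evaluation must grow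
-- together.
fr-⊕-mono : ∀ {a a′} b → fr a ⊑ fr a′ → eval a ≤ eval a′ → fr (a ⊕ b) ⊑ fr (a′ ⊕ b)
fr-⊕-mono {a} {a′} b a⊑a′ A≤A′ = ⊛-cancelʳ (ratio S A)
  (≲-trans (proj₁ (fr-⊕ a b)) (≲-trans (⊛-monoˡ _ a⊑a′)
    (≲-trans (proj₂ (fr-⊕ a′ b)) (⊛-monoʳ (fr (a′ ⊕ b)) (ratio-anti A (eval a′) (eval b) A≤A′)))))
  where
  A S : ℕ
  A = eval a
  S = A + eval b
  instance
    _ = eval≢0 a
    _ = eval≢0 a′
    _ = m^n≢0 S 3 {{+≢0 A (eval b)}}

fr-⊕-≺ : ∀ a b → fr (a ⊕ b) ≺ fr a ⊛ powerOf3 (ones b)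
fr-⊕-≺ a b p⊑ with
  *-cancelˡ-≤ {m = (eval a + eval b) ^ 3} (3 ^ ones a * 3 ^ ones b) (subst₂ _≤_ refl
    (cong₂ _*_ (^-distribˡ-+-* 3 (ones a) (ones b)) (*-identityʳ (eval a ^ 3)))
    (uncross p⊑))
  where instance _ = m*n≢0 (3 ^ ones a) (3 ^ ones b) {{3^≢0 (ones a)}} {{3^≢0 (ones b)}}
... | le = <⇒≱ (^-monoˡ-< 3 (m<m+n (eval a) (>-nonZero⁻¹ (eval b) {{eval≢0 b}}))) le

fr-⊕-lower : ∀ n a b → 3 ^ n ≤ eval a →
  fr a ⊛ powerOf3 (ones b) ⊑ fr (a ⊕ b) ⊛ stretch n (eval b)
fr-⊕-lower n a b le = ≲-trans (proj₂ (fr-⊕ a b))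
  (⊛-monoʳ (fr (a ⊕ b)) (ratio-anti (3 ^ n) (eval a) (eval b) le))
  where instance _ = eval≢0 a ; _ = 3^≢0 n

-- (1 + B/M)(1 + C/M) is at most 1 + (B + C + BC)/M because M = 3ⁿ is at least 1. Errors of nested
-- sums thus merge into one constant.
stretch-⊛ : ∀ n B C → stretch n B ⊛ stretch n C ⊑ stretch n (B + C + B * C)
stretch-⊛ n B C = cross (begin
  (M + B) ^ 3 * (M + C) ^ 3 * M ^ 3
    ≡⟨ cong (_* M ^ 3) (^-distribʳ-* 3 (M + B) (M + C)) ⟨
  ((M + B) * (M + C)) ^ 3 * M ^ 3
    ≤⟨ *-monoˡ-≤ (M ^ 3) (^-monoˡ-≤ 3 le) ⟩
  ((M + (B + C + B * C)) * M) ^ 3 * M ^ 3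
    ≡⟨ cong (_* M ^ 3) (^-distribʳ-* 3 (M + (B + C + B * C)) M) ⟩
  (M + (B + C + B * C)) ^ 3 * M ^ 3 * M ^ 3
    ≡⟨ *-assoc ((M + (B + C + B * C)) ^ 3) (M ^ 3) (M ^ 3) ⟩
  (M + (B + C + B * C)) ^ 3 * (M ^ 3 * M ^ 3) ∎)
  where
  open ≤-Reasoning
  M : ℕ
  M = 3 ^ n
  expand : ∀ m b c → (m + b) * (m + c) ≡ (m + (b + c)) * m + b * c * 1
  expand = solve-∀
  collect : ∀ m b c → (m + (b + c)) * m + b * c * m ≡ (m + (b + c + b * c)) * m
  collect = solve-∀
  le : (M + B) * (M + C) ≤ (M + (B + C + B * C)) * M
  le = begin
    (M + B) * (M + C)                  ≡⟨ expand M B C ⟩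
    (M + (B + C)) * M + B * C * 1      ≤⟨ +-monoʳ-≤ _ (*-monoʳ-≤ (B * C) (m^n>0 3 n)) ⟩
    (M + (B + C)) * M + B * C * M      ≡⟨ collect M B C ⟩
    (M + (B + C + B * C)) * M          ∎

n<3^n : ∀ n → n < 3 ^ n
n<3^n zero = s≤s z≤n
n<3^n (suc n) = begin-strict
  suc n              ≤⟨ n<3^n n ⟩
  3 ^ n              <⟨ m<m*n (3 ^ n) 3 {{3^≢0 n}} (s≤s (s≤s z≤n)) ⟩
  3 ^ n * 3          ≡⟨ *-comm (3 ^ n) 3 ⟩
  3 * 3 ^ n          ∎
  where open ≤-Reasoning

-- Cross-multiplied, `t ≺ u` is P < Q, hence P + 1 is at most Q. Since (M + B)³ is at most M³ + K
-- M², having P K < M suffices, and M = 3ⁿ exceeds n.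
stretch-small : ∀ {t u} B → t ≺ u → ∃ λ N → ∀ n → N ≤ n → t ⊛ stretch n B ≺ u
stretch-small {a // b} {c // d} B t≺u = P * K , bound
  where
  open ≤-Reasoning
  P Q K : ℕ
  P = a * d
  Q = c * b
  K = 3 * B + 3 * B * B + B * B * B
  P<Q : P < Q
  P<Q = ≺-uncross t≺u
  expand : ∀ m b → (m + b) * ((m + b) * ((m + b) * 1)) ≡
    m * (m * (m * 1)) + (3 * b * (m * m) + 3 * b * b * m + b * b * b * 1)
  expand = solve-∀
  collect : ∀ b m → 3 * b * m + 3 * b * b * m + b * b * b * m ≡
    (3 * b + 3 * b * b + b * b * b) * m
  collect = solve-∀
  cube : ∀ M → .{{NonZero M}} → (M + B) ^ 3 ≤ M ^ 3 + K * (M * M)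
  cube M = begin
    (M + B) ^ 3
      ≡⟨ expand M B ⟩
    M ^ 3 + (3 * B * (M * M) + 3 * B * B * M + B * B * B * 1)
      ≤⟨ +-monoʳ-≤ (M ^ 3) (+-mono-≤
           (+-monoʳ-≤ (3 * B * (M * M)) (*-monoʳ-≤ (3 * B * B) (m≤m*n M M)))
           (*-monoʳ-≤ (B * B * B) (>-nonZero⁻¹ (M * M) {{m*n≢0 M M}}))) ⟩
    M ^ 3 + (3 * B * (M * M) + 3 * B * B * (M * M) + B * B * B * (M * M))
      ≡⟨ cong (M ^ 3 +_) (collect B (M * M)) ⟩
    M ^ 3 + K * (M * M) ∎
  cubed : ∀ m → m * (m * m) ≡ m * (m * (m * 1))
  cubed = solve-∀
  rearr : ∀ a d s → a * s * d ≡ a * d * s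
  rearr = solve-∀
  bound : ∀ n → P * K ≤ n → a // b ⊛ stretch n B ≺ c // d
  bound n PK≤n = ≺-cross (begin-strict
    a * (M + B) ^ 3 * d        ≡⟨ rearr a d _ ⟩
    P * (M + B) ^ 3            ≤⟨ *-monoʳ-≤ P (cube M) ⟩
    P * (M ^ 3 + K * (M * M))  ≡⟨ *-distribˡ-+ P (M ^ 3) _ ⟩
    P * M ^ 3 + P * (K * (M * M)) ≡⟨ cong (P * M ^ 3 +_) (*-assoc P K (M * M)) ⟨
    P * M ^ 3 + P * K * (M * M)
      <⟨ +-monoʳ-< (P * M ^ 3) (*-monoˡ-< (M * M) {{m*n≢0 M M}} (≤-<-trans PK≤n (n<3^n n))) ⟩
    P * M ^ 3 + M * (M * M)    ≡⟨ cong (P * M ^ 3 +_) (cubed M) ⟩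
    P * M ^ 3 + M ^ 3          ≡⟨ +-comm (P * M ^ 3) _ ⟩
    suc P * M ^ 3              ≤⟨ *-monoˡ-≤ (M ^ 3) P<Q ⟩
    Q * M ^ 3                  ≡⟨ *-assoc c b _ ⟩
    c * (b * M ^ 3)            ∎)
    where
    M : ℕ
    M = 3 ^ n
    instance _ = 3^≢0 n

T : Expr → Expr
T e = e ⊗ one

pad : ℕ → Expr → Expr
pad zero e = e
pad (suc c) e = T (pad c e)

three : Expr
three = (one ⊕ one) ⊕ one

times3^ : Expr → ℕ → Expr
times3^ e zero = e
times3^ e (suc k) = times3^ e k ⊗ three

fr-T : ∀ e → fr (T e) ≈ triple (fr e)
fr-T e = fr-⊗ e one

fr-pad : ∀ c e → fr (pad c e) ≈ fr e ⊛ powerOf3 c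
fr-pad zero e = ≈-sym (⊛-identityʳ 1 (fr e))
fr-pad (suc c) e = ≈-trans (fr-T (pad c e)) (≈-trans (⊛-congˡ (3 // 1) (fr-pad c e))
  (≈-trans (⊛-assoc (fr e) (powerOf3 c) (3 // 1)) (⊛-congʳ (fr e) (⊛-comm (powerOf3 c) (3 // 1)))))

eval-times3^ : ∀ e k → eval (times3^ e k) ≡ eval e * 3 ^ k
eval-times3^ e zero = sym (*-identityʳ _)
eval-times3^ e (suc k) = trans (cong (_* 3) (eval-times3^ e k))
  (trans (*-assoc (eval e) (3 ^ k) 3) (cong (eval e *_) (*-comm (3 ^ k) 3)))

ones-times3^ : ∀ e k → ones (times3^ e k) ≡ ones e + 3 * k
ones-times3^ e zero = sym (+-identityʳ _)
ones-times3^ e (suc k) = trans (cong (_+ 3) (ones-times3^ e k)) (lem (ones e) k)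
  where
  lem : ∀ o k → o + 3 * k + 3 ≡ o + 3 * suc k
  lem = solve-∀

fr-cong : ∀ {e f} → ones e ≡ ones f → eval e ≡ eval f → fr e ≈ fr f
fr-cong o v = ≈-cross (cong₂ (λ o v → 3 ^ o * v ^ 3) o (sym v))

fr-times3^ : ∀ e k → fr (times3^ e k) ≈ fr e
fr-times3^ e zero = ≈-refl
fr-times3^ e (suc k) = ≈-trans (fr-⊗ (times3^ e k) three)
  (≈-trans (⊛-identityʳ 27 (fr (times3^ e k))) (fr-times3^ e k))

-- Families of expressions parametrised by exponents of 3

-- The evaluations are compared too, since values alone do not determine how a later summand acts.
Up : Expr → Expr → Set
Up e e′ = fr e ⊑ fr e′ × eval e ≤ eval e′

-- The value of `e` lies below the limit `triple (fr l)` and misses it by a factor of at most (1 + B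
-- / 3ⁿ)³. The field `large` keeps the error small when a further summand is added.
record Approx (B n : ℕ) (e l : Expr) : Set where
  field
    upper : fr e ≺ triple (fr l)
    lower : triple (fr l) ⊑ fr e ⊛ stretch n B
    large : 3 ^ n ≤ eval e
open Approx

⊛-mono-≺ : ∀ {x y} z → .{{NonZero (Frac.num z)}} → x ≺ y → x ⊛ z ≺ y ⊛ z
⊛-mono-≺ z x≺y q = x≺y (⊛-cancelʳ z q)

fr-num≢0 : ∀ e → NonZero (Frac.num (fr e))
fr-num≢0 e = 3^≢0 (ones e)

triple-⊛ : ∀ x z → triple x ⊛ z ≈ triple (x ⊛ z)
triple-⊛ x z = ⊛-swap x (3 // 1) z

triple-cong : ∀ {x y} → x ≈ y → triple x ≈ triple y
triple-cong = ⊛-congˡ (3 // 1)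

Up-⊗ʳ : ∀ {e e′} f → Up e e′ → Up (e ⊗ f) (e′ ⊗ f)
Up-⊗ʳ {e} {e′} f (p , q) =
  ≲-trans (proj₁ (fr-⊗ e f)) (≲-trans (⊛-monoˡ (fr f) p) (proj₂ (fr-⊗ e′ f))) ,
  *-monoˡ-≤ (eval f) q

⊗-comm-fr : ∀ e f → fr (e ⊗ f) ≈ fr (f ⊗ e)
⊗-comm-fr e f = fr-cong {e ⊗ f} {f ⊗ e} (+-comm (ones e) (ones f)) (*-comm (eval e) (eval f))

Up-⊗ˡ : ∀ {e e′} f → Up e e′ → Up (f ⊗ e) (f ⊗ e′)
Up-⊗ˡ {e} {e′} f up with p , q ← Up-⊗ʳ {e} {e′} f up =
  ≲-trans (proj₁ (⊗-comm-fr f e)) (≲-trans p (proj₁ (⊗-comm-fr e′ f))) ,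
  subst₂ _≤_ (*-comm (eval e) (eval f)) (*-comm (eval e′) (eval f)) q

Approx-⊗ʳ : ∀ {B n e l} f → Approx B n e l → Approx B n (e ⊗ f) (l ⊗ f)
Approx-⊗ʳ {B} {n} {e} {l} f a = record
  { upper = ≲-≺-trans (proj₁ (fr-⊗ e f))
      (≺-≲-trans (⊛-mono-≺ (fr f) {{fr-num≢0 f}} (upper a)) (proj₁ limit))
  ; lower = ≲-trans (proj₂ limit) (≲-trans (⊛-monoˡ (fr f) (lower a))
      (proj₁ (≈-trans (⊛-swap (fr e) (stretch n B) (fr f))
        (⊛-congˡ (stretch n B) (≈-sym (fr-⊗ e f))))))
  ; large = ≤-trans (large a) (m≤m*n (eval e) (eval f) {{eval≢0 f}})
  }
  where
  limit : triple (fr l) ⊛ fr f ≈ triple (fr (l ⊗ f))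
  limit = ≈-trans (triple-⊛ (fr l) (fr f)) (triple-cong (≈-sym (fr-⊗ l f)))

Approx-resp : ∀ {B n e e′ l l′} → fr e ≈ fr e′ → eval e ≡ eval e′ → fr l ≈ fr l′ →
  Approx B n e l → Approx B n e′ l′
Approx-resp {B} {n} {e} {e′} {l} {l′} e≈ ev l≈ a = record
  { upper = ≲-≺-trans (proj₂ e≈) (≺-≲-trans (upper a) (proj₁ (triple-cong l≈)))
  ; lower = ≲-trans (proj₂ (triple-cong l≈))
      (≲-trans (lower a) (⊛-monoˡ (stretch n B) (proj₁ e≈)))
  ; large = subst (3 ^ n ≤_) ev (large a)
  }

Approx-⊗ˡ : ∀ {B n e l} f → Approx B n e l → Approx B n (f ⊗ e) (f ⊗ l)
Approx-⊗ˡ {e = e} {l} f a = Approx-resp {e = e ⊗ f} {f ⊗ e} {l ⊗ f} {f ⊗ l}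
  (⊗-comm-fr e f) (*-comm (eval e) (eval f)) (⊗-comm-fr l f) (Approx-⊗ʳ f a)

Up-times3^-⊕ : ∀ {e e′} k b → Up e e′ → Up (times3^ e k ⊕ b) (times3^ e′ k ⊕ b)
Up-times3^-⊕ {e} {e′} k b (p , q) =
  fr-⊕-mono {times3^ e k} {times3^ e′ k} b
    (≲-trans (proj₁ (fr-times3^ e k)) (≲-trans p (proj₂ (fr-times3^ e′ k)))) le ,
  +-monoˡ-≤ (eval b) le
  where
  le : eval (times3^ e k) ≤ eval (times3^ e′ k)
  le = subst₂ _≤_ (sym (eval-times3^ e k)) (sym (eval-times3^ e′ k)) (*-monoˡ-≤ (3 ^ k) q)

Up-times3^-suc : ∀ e k b → Up (times3^ e k ⊕ b) (times3^ e (suc k) ⊕ b)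
Up-times3^-suc e k b =
  fr-⊕-mono {times3^ e k} {times3^ e (suc k)} b
    (proj₁ (≈-trans (fr-times3^ e k) (≈-sym (fr-times3^ e (suc k))))) le ,
  +-monoˡ-≤ (eval b) le
  where
  le : eval (times3^ e k) ≤ eval (times3^ e k) * 3
  le = m≤m*n (eval (times3^ e k)) 3

eval≤eval-times3^ : ∀ e k → eval e ≤ eval (times3^ e k)
eval≤eval-times3^ e k =
  subst (eval e ≤_) (sym (eval-times3^ e k)) (m≤m*n (eval e) (3 ^ k) {{3^≢0 k}})

-- The old error and that of the new summand combine by `stretch-⊛`; in the limit `b` only
-- contributes its cost, which `pad` records.
Approx-times3^-⊕ : ∀ {B n e l} k b → Approx B n e l →
  Approx (B + eval b + B * eval b) n (times3^ e k ⊕ b) (pad (ones b) l)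
Approx-times3^-⊕ {B} {n} {e} {l} k b a = record
  { upper = ≺-≲-trans (fr-⊕-≺ e′ b)
      (≲-trans (⊛-monoˡ P (≲-trans (proj₁ (fr-times3^ e k)) (≺⇒≲ (upper a)))) (proj₁ limit))
  ; lower = ≲-trans (proj₂ limit) (≲-trans (⊛-monoˡ P (lower a))
      (≲-trans (proj₁ (⊛-swap (fr e) S P)) (≲-trans (⊛-monoˡ S bound)
      (≲-trans (proj₁ (⊛-assoc (fr (e′ ⊕ b)) S′ S)) (⊛-monoʳ (fr (e′ ⊕ b))
      (≲-trans (proj₁ (⊛-comm S′ S)) (stretch-⊛ n B (eval b))))))))
  ; large = ≤-trans large′ (m≤m+n (eval e′) (eval b))
  }
  where
  e′ : Expr
  e′ = times3^ e k
  P S S′ : Frac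
  P = powerOf3 (ones b)
  S = stretch n B
  S′ = stretch n (eval b)
  large′ : 3 ^ n ≤ eval e′
  large′ = ≤-trans (large a) (eval≤eval-times3^ e k)
  limit : triple (fr l) ⊛ P ≈ triple (fr (pad (ones b) l))
  limit = ≈-trans (triple-⊛ (fr l) P) (triple-cong (≈-sym (fr-pad (ones b) l)))
  bound : fr e ⊛ P ⊑ fr (e′ ⊕ b) ⊛ S′
  bound = ≲-trans (⊛-monoˡ P (proj₂ (fr-times3^ e k))) (fr-⊕-lower n e′ b large′)

ones≢0 : ∀ e → NonZero (ones e)
ones≢0 one = _
ones≢0 (e ⊕ f) = +≢0 (ones e) (ones f) {{ones≢0 e}}
ones≢0 (e ⊗ f) = +≢0 (ones e) (ones f) {{ones≢0 e}}

-- The limit of e · 3ⁿ + b is `fr e` times 3 to the power `ones b`. One of these threes is the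
-- factor built into `Approx`, so only `pred (ones b)` ones remain as padding.
Approx-fresh : ∀ n e b → Approx (eval b) n (times3^ e n ⊕ b) (pad (pred (ones b)) e)
Approx-fresh n e b = record
  { upper = ≺-≲-trans (fr-⊕-≺ e′ b)
      (≲-trans (⊛-monoˡ P (proj₁ (fr-times3^ e n))) (proj₁ limit))
  ; lower = ≲-trans (proj₂ limit)
      (≲-trans (⊛-monoˡ P (proj₂ (fr-times3^ e n))) (fr-⊕-lower n e′ b large′))
  ; large = ≤-trans large′ (m≤m+n (eval e′) (eval b))
  }
  where
  e′ : Expr
  e′ = times3^ e n
  P : Frac
  P = powerOf3 (ones b)
  large′ : 3 ^ n ≤ eval e′
  large′ = subst (3 ^ n ≤_) (sym (eval-times3^ e n)) (m≤n*m (3 ^ n) (eval e) {{eval≢0 e}})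
  limit : fr e ⊛ P ≈ triple (fr (pad (pred (ones b)) e))
  limit = ≈-trans (subst (λ c → fr e ⊛ powerOf3 (ones b) ≈ fr (pad c e))
      (sym (suc-pred (ones b) {{ones≢0 b}})) (≈-sym (fr-pad (ones b) e)))
    (fr-T (pad (pred (ones b)) e))

-- In `node g l` the slice g n fixes the outermost exponent at n, and the values of
-- the slices tend to three times those of l.
data Mono : ℕ → Set where
  leaf : Expr → Mono 0
  node : ∀ {d} → (ℕ → Mono d) → Mono d → Mono (suc d)

at : ∀ {d} → Mono d → Vec ℕ d → Expr
at (leaf e) [] = e
at (node g l) (n ∷ m) = at (g n) m

-- `B` is chosen before `n` and `m`: the rate of convergence in the outermost exponent is uniform in
-- the inner ones.
Valid : ∀ {d} → Mono d → Set
Valid (leaf e) = ⊤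
Valid (node g l) = (∀ n → Valid (g n)) × Valid l
  × (∀ n m → Up (at (g n) m) (at (g (suc n)) m))
  × ∃ λ B → ∀ n m → Approx B n (at (g n) m) (at l m)

mapᴹ : ∀ {d} → (Expr → Expr) → Mono d → Mono d
mapᴹ f (leaf e) = leaf (f e)
mapᴹ f (node g l) = node (λ n → mapᴹ f (g n)) (mapᴹ f l)

at-map : ∀ {d} f (M : Mono d) m → at (mapᴹ f M) m ≡ f (at M m)
at-map f (leaf e) [] = refl
at-map f (node g l) (n ∷ m) = at-map f (g n) m

map-valid : ∀ {d} f →
  (∀ {e e′} → Up e e′ → Up (f e) (f e′)) →
  (∀ {B n e l} → Approx B n e l → Approx B n (f e) (f l)) →
  (M : Mono d) → Valid M → Valid (mapᴹ f M)
map-valid f up ap (leaf e) _ = tt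
map-valid f up ap (node g l) (vg , vl , gu , B , ga) =
  (λ n → map-valid f up ap (g n) (vg n)) , map-valid f up ap l vl ,
  (λ n m → subst₂ Up (sym (at-map f (g n) m)) (sym (at-map f (g (suc n)) m)) (up (gu n m))) ,
  B , λ n m → subst₂ (Approx B n) (sym (at-map f (g n) m)) (sym (at-map f l m)) (ap (ga n m))

⊗-valid : ∀ {d} e (M : Mono d) → Valid M → Valid (mapᴹ (e ⊗_) M)
⊗-valid e = map-valid (e ⊗_) (λ {f} {f′} → Up-⊗ˡ {f} {f′} e) (Approx-⊗ˡ e)

pad-valid : ∀ {d} c (M : Mono d) → Valid M → Valid (mapᴹ (pad c) M)
pad-valid c = map-valid (pad c) (up c) (ap c)
  where
  up : ∀ c {e e′} → Up e e′ → Up (pad c e) (pad c e′)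
  up zero u = u
  up (suc c) {e} {e′} u = Up-⊗ʳ {pad c e} {pad c e′} one (up c {e} {e′} u)
  ap : ∀ c {B n e l} → Approx B n e l → Approx B n (pad c e) (pad c l)
  ap zero a = a
  ap (suc c) a = Approx-⊗ʳ one (ap c a)

_⊗ᴹ_ : ∀ {c d} → Mono c → Mono d → Mono (c + d)
leaf e ⊗ᴹ M = mapᴹ (e ⊗_) M
node g l ⊗ᴹ M = node (λ n → g n ⊗ᴹ M) (l ⊗ᴹ M)

at-⊗ : ∀ {c d} (M : Mono c) (N : Mono d) m →
  at (M ⊗ᴹ N) m ≡ at M (take c m) ⊗ at N (drop c m)
at-⊗ (leaf e) N m = at-map (e ⊗_) N m
at-⊗ (node g l) N (n ∷ m) = at-⊗ (g n) N m

at-⊗-++ : ∀ {c d} (M : Mono c) (N : Mono d) m m′ →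
  at (M ⊗ᴹ N) (m ++ᵛ m′) ≡ at M m ⊗ at N m′
at-⊗-++ (leaf e) N [] m′ = at-map (e ⊗_) N m′
at-⊗-++ (node g l) N (n ∷ m) m′ = at-⊗-++ (g n) N m m′

⊗ᴹ-valid : ∀ {c d} (M : Mono c) (N : Mono d) → Valid M → Valid N → Valid (M ⊗ᴹ N)
⊗ᴹ-valid (leaf e) N _ vN = ⊗-valid e N vN
⊗ᴹ-valid (node g l) N (vg , vl , gu , B , ga) vN =
  (λ n → ⊗ᴹ-valid (g n) N (vg n) vN) , ⊗ᴹ-valid l N vl vN ,
  (λ n m → subst₂ Up (sym (at-⊗ (g n) N m)) (sym (at-⊗ (g (suc n)) N m))
    (Up-⊗ʳ {at (g n) _} {at (g (suc n)) _} (at N (drop _ m)) (gu n _))) ,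
  B , λ n m → subst₂ (Approx B n) (sym (at-⊗ (g n) N m)) (sym (at-⊗ l N m))
    (Approx-⊗ʳ (at N (drop _ m)) (ga n _))

-- In the limit of an inner variable the summand b becomes negligible, and only
-- its cost survives.
shiftᴹ : ∀ {d} → ℕ → Expr → Mono d → Mono d
shiftᴹ k b (leaf e) = leaf (times3^ e k ⊕ b)
shiftᴹ k b (node g l) = node (λ n → shiftᴹ k b (g n)) (mapᴹ (pad (ones b)) l)

at-shift : ∀ {d} k b (M : Mono d) m → at (shiftᴹ k b M) m ≡ times3^ (at M m) k ⊕ b
at-shift k b (leaf e) [] = refl
at-shift k b (node g l) (n ∷ m) = at-shift k b (g n) m

shift-valid : ∀ {d} k b (M : Mono d) → Valid M → Valid (shiftᴹ k b M)
shift-valid k b (leaf e) _ = tt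
shift-valid k b (node g l) (vg , vl , gu , B , ga) =
  (λ n → shift-valid k b (g n) (vg n)) , pad-valid (ones b) l vl ,
  (λ n m → subst₂ Up (sym (at-shift k b (g n) m)) (sym (at-shift k b (g (suc n)) m))
    (Up-times3^-⊕ {at (g n) m} {at (g (suc n)) m} k b (gu n m))) ,
  B + eval b + B * eval b , λ n m →
    subst₂ (Approx _ n) (sym (at-shift k b (g n) m)) (sym (at-map (pad (ones b)) l m))
      (Approx-times3^-⊕ k b (ga n m))

-- Turns e into e · 3ⁿ + b with the fresh exponent n outermost.
extendᴹ : ∀ {d} → Expr → Mono d → Mono (suc d)
extendᴹ b M = node (λ n → shiftᴹ n b M) (mapᴹ (pad (pred (ones b))) M)

extend-valid : ∀ {d} b (M : Mono d) → Valid M → Valid (extendᴹ b M)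
extend-valid b M v =
  (λ n → shift-valid n b M v) , pad-valid (pred (ones b)) M v ,
  (λ n m → subst₂ Up (sym (at-shift n b M m)) (sym (at-shift (suc n) b M m))
    (Up-times3^-suc (at M m) n b)) ,
  eval b , λ n m →
    subst₂ (Approx _ n) (sym (at-shift n b M m)) (sym (at-map (pad (pred (ones b))) M m))
      (Approx-fresh n (at M m) b)

-- Values of families on either side of a threshold

Family : Set
Family = Σ ℕ λ d → Σ (Mono d) Valid

_∈ᶠ_ : Expr → Family → Set
e ∈ᶠ (d , M , _) = ∃ λ m → at M m ≡ e

-- Expresses that values of `E` do not accumulate at `t` from above: finitely many bounds, all
-- strictly above `t`, lie under all values of `E` exceeding `t`.
record Above (t : Frac) (E : Expr → Set) : Set where
  field
    bounds : List Expr
    above : All (λ l → t ≺ fr l) bounds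
    minimal : ∀ {e} → E e → t ≺ fr e → Any (λ l → fr l ⊑ fr e) bounds
open Above

above-∪ : ∀ {t D E F} → (∀ {e} → F e → D e ⊎ E e) → Above t D → Above t E → Above t F
above-∪ split a b = record
  { bounds = bounds a ++ bounds b
  ; above = All.++⁺ (above a) (above b)
  ; minimal = λ e∈F t≺e → [ (λ e∈D → Any.++⁺ˡ (minimal a e∈D t≺e))
                          , (λ e∈E → Any.++⁺ʳ (bounds a) (minimal b e∈E t≺e)) ]′ (split e∈F)
  }

above-up-to : ∀ {t} {E : ℕ → Expr → Set} → (∀ n → Above t (E n)) →
  ∀ N → Above t (λ e → ∃ λ n → n ≤ N × E n e)
above-up-to {E = E} a zero = above-∪ {D = E 0} {E = E 0} (λ { (_ , z≤n , p) → inj₁ p }) (a 0) (a 0)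
above-up-to {t} {E} a (suc N) = above-∪ split (a (suc N)) (above-up-to a N)
  where
  split : ∀ {e} → (∃ λ n → n ≤ suc N × E n e) → E (suc N) e ⊎ ∃ λ n → n ≤ N × E n e
  split (n , n≤ , p) with m≤n⇒m<n∨m≡n n≤
  ... | inj₁ n< = inj₂ (n , s≤s⁻¹ n< , p)
  ... | inj₂ refl = inj₁ p

≺third⇒triple≺ : ∀ {x y} → third x ≺ y → x ≺ triple y
≺third⇒triple≺ p q = p (triple⊑⇒⊑third q)

triple≺⇒≺third : ∀ {x y} → x ≺ triple y → third x ≺ y
triple≺⇒≺third p q = p (⊑third⇒triple⊑ q)

sequence-mono : ∀ {d} (g : ℕ → Mono d) → (∀ n m → Up (at (g n) m) (at (g (suc n)) m)) →
  ∀ m {n n′} → n ≤ n′ → fr (at (g n) m) ⊑ fr (at (g n′) m)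
sequence-mono g up m {n} {n′} n≤n′ = go (≤⇒≤′ n≤n′)
  where
  go : ∀ {n′} → n ≤′ n′ → fr (at (g n) m) ⊑ fr (at (g n′) m)
  go ≤′-refl = ≲-refl
  go (≤′-step {n″} p) = ≲-trans (go p) (proj₁ (up n″ m))

-- Finitely many values separate t / 3 from the larger limits, so a single index
-- N pushes every sequence whose limit exceeds t beyond t.
uniform-bound : ∀ {d} {t B} (g : ℕ → Mono d) (l : Mono d) →
  (∀ n m → Approx B n (at (g n) m) (at l m)) →
  Above (third t) (λ e → ∃ λ m → at l m ≡ e) →
  ∃ λ N → ∀ m → t ≺ triple (fr (at l m)) → t ≺ fr (at (g N) m)
uniform-bound {t = t} {B} g l approx a with common (bounds a) (above a)
  where
  common : ∀ L → All (λ e → third t ≺ fr e) L →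
    ∃ λ N → ∀ n → N ≤ n → All (λ e → t ⊛ stretch n B ≺ triple (fr e)) L
  common [] [] = 0 , λ _ _ → []
  common (e ∷ L) (p ∷ ps)
    with N , f ← stretch-small {t} {triple (fr e)} B (≺third⇒triple≺ {t} {fr e} p) | N′ , f′ ← common L ps
    = N ⊔ N′ , λ n le → f n (≤-trans (m≤m⊔n N N′) le) ∷ f′ n (≤-trans (m≤n⊔m N N′) le)
... | N , f = N , λ m t≺lim fr⊑t →
  let (e , e∈ , e⊑) = find (minimal a (m , refl) (triple≺⇒≺third {t} {fr (at l m)} t≺lim)) in
  All.lookup (f N ≤-refl) e∈ (≲-trans {triple (fr e)} (⊛-monoˡ (3 // 1) e⊑)
    (≲-trans {triple (fr (at l m))} (lower (approx N m)) (⊛-monoˡ (stretch N B) fr⊑t)))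
  where open Approx

-- A member above `t` has its limit above `t`, so slice `N` is already above `t` there. Slices
-- beyond `N` dominate slice `N`, which leaves the finitely many slices up to `N`.
node-above : ∀ {d t B} (g : ℕ → Mono d) (l : Mono d) →
  (∀ n m → Up (at (g n) m) (at (g (suc n)) m)) →
  (∀ n m → Approx B n (at (g n) m) (at l m)) →
  Above (third t) (λ e → ∃ λ m → at l m ≡ e) →
  (∀ n → Above t (λ e → ∃ λ m → at (g n) m ≡ e)) →
  Above t (λ e → ∃ λ m → at (node g l) m ≡ e)
node-above {t = t} g l up approx al ag = record { bounds = bounds A ; above = above A ; minimal = min }
  where
  N : ℕ
  N = proj₁ (uniform-bound g l approx al)
  reached : ∀ m → t ≺ triple (fr (at l m)) → t ≺ fr (at (g N) m)
  reached = proj₂ (uniform-bound g l approx al)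
  A : Above t (λ e → ∃ λ n → n ≤ N × ∃ λ m → at (g n) m ≡ e)
  A = above-up-to ag N
  min : ∀ {e} → (∃ λ m → at (node g l) m ≡ e) → t ≺ fr e →
    Any (λ k → fr k ⊑ fr e) (bounds A)
  min (n ∷ m , refl) t≺e with ≤-total n N
  ... | inj₁ n≤N = minimal A (n , n≤N , m , refl) t≺e
  ... | inj₂ N≤n = Any.map (λ {k} k⊑ → ≲-trans {fr k} k⊑ (sequence-mono g up m N≤n))
    (minimal A (N , ≤-refl , m , refl)
      (reached m (≺-≲-trans {t} {fr (at (g n) m)} t≺e (≺⇒≲ {fr (at (g n) m)} (Approx.upper (approx n m))))))

leaf-above : ∀ e t → Above t (λ f → ∃ λ m → at (leaf e) m ≡ f)
leaf-above e t with fr e ≲? t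
... | yes e⊑t = record
  { bounds = []
  ; above = []
  ; minimal = λ { ([] , refl) t≺e → ⊥-elim (t≺e e⊑t) }
  }
... | no t≺e = record
  { bounds = e ∷ []
  ; above = t≺e ∷ []
  ; minimal = λ { ([] , refl) _ → here ≲-refl }
  }

mono-above : ∀ {d} (M : Mono d) → Valid M → ∀ t → Above t (λ e → ∃ λ m → at M m ≡ e)
mono-above (leaf e) _ t = leaf-above e t
mono-above (node g l) (vg , vl , up , B , approx) t =
  node-above g l up approx (mono-above l vl (third t)) (λ n → mono-above (g n) (vg n) t)

-- Below `t` the members are finitely many points, up to those lying under one of finitely many
-- limits that are themselves at most `t`. The largest such limit yields the floor of `t`.
record Boxes (t : Frac) (E : Expr → Set) : Set where
  field
    points limits : List Expr
    points⊑ : All (λ f → fr f ⊑ t) points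
    limits⊑ : All (λ v → triple (fr v) ⊑ t) limits
    covered : ∀ {e} → E e → fr e ⊑ t →
      e ∈ points ⊎ Any (λ v → fr e ≺ triple (fr v)) limits
open Boxes

boxes-∪ : ∀ {t D E F} → (∀ {e} → F e → fr e ⊑ t → D e ⊎ E e) →
  Boxes t D → Boxes t E → Boxes t F
boxes-∪ split a b = record
  { points = points a ++ points b
  ; limits = limits a ++ limits b
  ; points⊑ = All.++⁺ (points⊑ a) (points⊑ b)
  ; limits⊑ = All.++⁺ (limits⊑ a) (limits⊑ b)
  ; covered = λ e∈F e⊑t →
      [ (λ e∈D → [ inj₁ ∘ Any.++⁺ˡ , inj₂ ∘ Any.++⁺ˡ ]′ (covered a e∈D e⊑t))
      , (λ e∈E → [ inj₁ ∘ Any.++⁺ʳ (points a) , inj₂ ∘ Any.++⁺ʳ (limits a) ]′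
                   (covered b e∈E e⊑t)) ]′ (split e∈F e⊑t)
  }

boxes-up-to : ∀ {t} {E : ℕ → Expr → Set} → (∀ n → Boxes t (E n)) →
  ∀ N → Boxes t (λ e → ∃ λ n → n ≤ N × E n e)
boxes-up-to {E = E} b zero =
  boxes-∪ {D = E 0} {E = E 0} (λ { (_ , z≤n , p) _ → inj₁ p }) (b 0) (b 0)
boxes-up-to {t} {E} b (suc N) = boxes-∪ split (b (suc N)) (boxes-up-to b N)
  where
  split : ∀ {e} → (∃ λ n → n ≤ suc N × E n e) → fr e ⊑ t →
    E (suc N) e ⊎ ∃ λ n → n ≤ N × E n e
  split (n , n≤ , p) _ with m≤n⇒m<n∨m≡n n≤
  ... | inj₁ n< = inj₂ (n , s≤s⁻¹ n< , p)
  ... | inj₂ refl = inj₁ p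

leaf-boxes : ∀ e t → Boxes t (λ f → ∃ λ m → at (leaf e) m ≡ f)
leaf-boxes e t with fr e ≲? t
... | yes e⊑t = record
  { points = e ∷ []
  ; limits = []
  ; points⊑ = e⊑t ∷ []
  ; limits⊑ = []
  ; covered = λ { ([] , refl) _ → inj₁ (here refl) }
  }
... | no t≺e = record
  { points = []
  ; limits = []
  ; points⊑ = []
  ; limits⊑ = []
  ; covered = λ { ([] , refl) e⊑t → ⊥-elim (t≺e e⊑t) }
  }

-- Slices up to `N` are handled one by one. Beyond `N`, a member of value at most `t` must have its
-- limit at most `t`, by the choice of `N`, and lies below that limit.
node-boxes : ∀ {d t B} (g : ℕ → Mono d) (l : Mono d) →
  (∀ n m → Up (at (g n) m) (at (g (suc n)) m)) →
  (∀ n m → Approx B n (at (g n) m) (at l m)) →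
  Above (third t) (λ e → ∃ λ m → at l m ≡ e) →
  Boxes (third t) (λ e → ∃ λ m → at l m ≡ e) →
  (∀ n → Boxes t (λ e → ∃ λ m → at (g n) m ≡ e)) →
  Boxes t (λ e → ∃ λ m → at (node g l) m ≡ e)
node-boxes {t = t} g l up approx al L bg = boxes-∪ split limitBoxes (boxes-up-to bg N)
  where
  N : ℕ
  N = proj₁ (uniform-bound g l approx al)
  reached : ∀ m → t ≺ triple (fr (at l m)) → t ≺ fr (at (g N) m)
  reached = proj₂ (uniform-bound g l approx al)

  Tail : Expr → Set
  Tail e = ∃ λ n → ∃ λ m → at (g n) m ≡ e × triple (fr (at l m)) ⊑ t

  limitBoxes : Boxes t Tail
  limitBoxes = record
    { points = []
    -- A point f of `l` is itself the index of a limit `triple (fr f)`. Members of `l` below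
    -- `triple (fr v)` have their own limits below the one indexed by `T v`.
    ; limits = points L ++ map T (limits L)
    ; points⊑ = []
    ; limits⊑ = All.++⁺ (All.map (λ {f} → ⊑third⇒triple⊑ {fr f} {t}) (points⊑ L))
        (All.map⁺ (All.map (λ {v} p → ⊑third⇒triple⊑ {fr (T v)} {t}
          (≲-trans {fr (T v)} {triple (fr v)} (proj₁ (fr-T v)) p)) (limits⊑ L)))
    ; covered = cov
    }
    where
    cov : ∀ {e} → Tail e → fr e ⊑ t →
      e ∈ [] ⊎ Any (λ v → fr e ≺ triple (fr v)) (points L ++ map T (limits L))
    cov (n , m , refl , lim⊑t) _ =
      [ (λ p → inj₂ (Any.++⁺ˡ (lose p (Approx.upper (approx n m)))))
      , (λ p → inj₂ (Any.++⁺ʳ (points L) (Any.map⁺ (Any.map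
          (λ {v} lt → ≺-≲-trans {fr (at (g n) m)} {triple (fr (at l m))} {triple (fr (T v))}
            (Approx.upper (approx n m))
            (⊛-monoˡ (3 // 1) (≲-trans {fr (at l m)} {triple (fr v)} {fr (T v)}
              (≺⇒≲ {fr (at l m)} {triple (fr v)} lt) (proj₂ (fr-T v))))) p))))
      ]′ (covered L (m , refl) (triple⊑⇒⊑third {fr (at l m)} {t} lim⊑t))

  split : ∀ {e} → (∃ λ m → at (node g l) m ≡ e) → fr e ⊑ t →
    Tail e ⊎ ∃ λ n → n ≤ N × ∃ λ m → at (g n) m ≡ e
  split (n ∷ m , refl) e⊑t with ≤-total n N
  ... | inj₁ n≤N = inj₂ (n , n≤N , m , refl)
  ... | inj₂ N≤n = inj₁ (n , m , refl , decidable-stable (triple (fr (at l m)) ≲? t) λ t≺lim →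
      reached m t≺lim (≲-trans {fr (at (g N) m)} (sequence-mono g up m N≤n) e⊑t))

mono-boxes : ∀ {d} (M : Mono d) → Valid M → ∀ t → Boxes t (λ e → ∃ λ m → at M m ≡ e)
mono-boxes (leaf e) _ t = leaf-boxes e t
mono-boxes (node g l) (vg , vl , up , B , approx) t = node-boxes g l up approx
  (mono-above l vl (third t)) (mono-boxes l vl (third t)) (λ n → mono-boxes (g n) (vg n) t)

families-above : ∀ (F : List Family) t → Above t (λ e → Any (e ∈ᶠ_) F)
families-above [] t = record { bounds = [] ; above = [] ; minimal = λ () }
families-above ((d , M , v) ∷ F) t =
  above-∪ (λ { (here p) → inj₁ p ; (there p) → inj₂ p }) (mono-above M v t) (families-above F t)

families-boxes : ∀ (F : List Family) t → Boxes t (λ e → Any (e ∈ᶠ_) F)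
families-boxes [] t = record
  { points = [] ; limits = [] ; points⊑ = [] ; limits⊑ = [] ; covered = λ () }
families-boxes ((d , M , v) ∷ F) t =
  boxes-∪ (λ { (here p) _ → inj₁ p ; (there p) _ → inj₂ p }) (mono-boxes M v t) (families-boxes F t)

-- Covering by finitely many families

-- Agreement up to a power of three leaves the value unchanged. The exponent is kept because a
-- summand added to `e` must be added to f · 3^exponent, not to `f`.
record Triples (e f : Expr) : Set where
  field
    exponent : ℕ
    same-eval : eval e ≡ eval (times3^ f exponent)
    same-ones : ones e ≡ ones (times3^ f exponent)
open Triples

triples-fr : ∀ {e f} → Triples e f → fr e ≈ fr f
triples-fr {e} {f} t = ≈-trans (fr-cong {e} {times3^ f (exponent t)} (same-ones t) (same-eval t))
  (fr-times3^ f (exponent t))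

triples-refl : ∀ {e f} → eval e ≡ eval f → ones e ≡ ones f → Triples e f
triples-refl p q = record { exponent = 0 ; same-eval = p ; same-ones = q }

triples : ∀ {e f} j → eval e ≡ eval f * 3 ^ j → ones e ≡ ones f + 3 * j → Triples e f
triples {f = f} j p q = record
  { exponent = j
  ; same-eval = trans p (sym (eval-times3^ f j))
  ; same-ones = trans q (sym (ones-times3^ f j))
  }

triples-eval : ∀ {e f} (t : Triples e f) → eval e ≡ eval f * 3 ^ exponent t
triples-eval {f = f} t = trans (same-eval t) (eval-times3^ f (exponent t))

triples-ones : ∀ {e f} (t : Triples e f) → ones e ≡ ones f + 3 * exponent t
triples-ones {f = f} t = trans (same-ones t) (ones-times3^ f (exponent t))

triples-⊗ : ∀ {e f e′ f′} → Triples e f → Triples e′ f′ → Triples (e ⊗ e′) (f ⊗ f′)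
triples-⊗ {e} {f} {e′} {f′} t t′ = triples {e ⊗ e′} {f ⊗ f′} (i + j)
  (trans (cong₂ _*_ (triples-eval t) (triples-eval t′))
    (trans ([m*n]*[o*p]≡[m*o]*[n*p] (eval f) (3 ^ i) (eval f′) (3 ^ j))
      (cong (eval f * eval f′ *_) (sym (^-distribˡ-+-* 3 i j)))))
  (trans (cong₂ _+_ (triples-ones t) (triples-ones t′)) (lem (ones f) i (ones f′) j))
  where
  i j : ℕ
  i = exponent t
  j = exponent t′
  lem : ∀ a i b j → (a + 3 * i) + (b + 3 * j) ≡ (a + b) + 3 * (i + j)
  lem = solve-∀

triples-three-⊗ : ∀ {e f g} → Triples e three → Triples f g → Triples (e ⊗ f) g
triples-three-⊗ {e} {f} {g} t t′ = triples {e ⊗ f} {g} (suc (i + j))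
  (trans (cong₂ _*_ (triples-eval t) (triples-eval t′))
    (trans (lem₁ (3 ^ i) (eval g) (3 ^ j))
      (cong (λ x → eval g * (3 * x)) (sym (^-distribˡ-+-* 3 i j)))))
  (trans (cong₂ _+_ (triples-ones t) (triples-ones t′)) (lem₂ i (ones g) j))
  where
  i j : ℕ
  i = exponent t
  j = exponent t′
  lem₁ : ∀ x a y → (3 * x) * (a * y) ≡ a * (3 * (x * y))
  lem₁ = solve-∀
  lem₂ : ∀ i a j → (3 + 3 * i) + (a + 3 * j) ≡ a + 3 * (1 + (i + j))
  lem₂ = solve-∀

triples-resp : ∀ {e e′ f} → eval e ≡ eval e′ → ones e ≡ ones e′ → Triples e f → Triples e′ f
triples-resp p q t = record
  { exponent = exponent t
  ; same-eval = trans (sym p) (same-eval t)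
  ; same-ones = trans (sym q) (same-ones t)
  }

triples-⊕ : ∀ {a f} b (t : Triples a f) → Triples (a ⊕ b) (times3^ f (exponent t) ⊕ b)
triples-⊕ {a} {f} b t = triples-refl {a ⊕ b} {times3^ f (exponent t) ⊕ b}
  (cong (_+ eval b) (same-eval t)) (cong (_+ ones b) (same-ones t))

-- Growth of values under addition

data SumCase (a b : Expr) : Set where
  grows : 9 // 8 ⊛ fr a ⊑ fr (a ⊕ b) → SumCase a b
  small : b ≡ one → eval a ≤ 2 → SumCase a b

ones≡1 : ∀ e → ones e ≤ 1 → e ≡ one
ones≡1 one _ = refl
ones≡1 (e ⊕ f) le = ⊥-elim (<⇒≱ (+-mono-≤ (>-nonZero⁻¹ _ {{ones≢0 e}}) (>-nonZero⁻¹ _ {{ones≢0 f}})) le)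
ones≡1 (e ⊗ f) le = ⊥-elim (<⇒≱ (+-mono-≤ (>-nonZero⁻¹ _ {{ones≢0 e}}) (>-nonZero⁻¹ _ {{ones≢0 f}})) le)

-- If `b` costs at least 2, the value is multiplied by at least 3² and divided by at most 2³, whence
-- 9/8. If `b` is `one` and `eval a` is at least 3, the factor is at least 3 · (3/4)³ = 81/64. Only
-- 1 + 1 and 2 + 1 remain.
sumCase : ∀ a b → eval b ≤ eval a → SumCase a b
sumCase a b B≤A with ones b ≤? 1 | eval a ≤? 2
... | yes le | yes A≤2 = small (ones≡1 b le) A≤2
... | yes le | no A≰2 with refl ← ones≡1 b le = grows (cross (begin
  9 * 3 ^ ones a * (A + 1) ^ 3  ≡⟨ rearr (3 ^ ones a) ((A + 1) ^ 3) ⟩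
  3 ^ ones a * (9 * (A + 1) ^ 3)  ≤⟨ *-monoʳ-≤ (3 ^ ones a) ineq ⟩
  3 ^ ones a * (3 * (8 * A ^ 3))  ≡⟨ *-assoc (3 ^ ones a) 3 _ ⟨
  3 ^ ones a * 3 * (8 * A ^ 3)  ≡⟨ cong (_* (8 * A ^ 3)) (^-distribˡ-+-* 3 (ones a) 1) ⟨
  3 ^ (ones a + 1) * (8 * A ^ 3)  ∎))
  where
  open ≤-Reasoning
  A : ℕ
  A = eval a
  rearr : ∀ p x → 9 * p * x ≡ p * (9 * x)
  rearr = solve-∀
  rearr₁ : ∀ x → 3 * (9 * x) ≡ 27 * x
  rearr₁ = solve-∀
  rearr₂ : ∀ x → 72 * x ≡ 3 * (3 * (8 * x))
  rearr₂ = solve-∀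
  step : 3 * (A + 1) ≤ 4 * A
  step = begin
    3 * (A + 1)  ≡⟨ *-distribˡ-+ 3 A 1 ⟩
    3 * A + 3    ≤⟨ +-monoʳ-≤ (3 * A) (≰⇒> A≰2) ⟩
    3 * A + A    ≡⟨ +-comm (3 * A) A ⟩
    4 * A        ∎
  ineq : 9 * (A + 1) ^ 3 ≤ 3 * (8 * A ^ 3)
  ineq = *-cancelˡ-≤ 3 (begin
    3 * (9 * (A + 1) ^ 3)  ≡⟨ rearr₁ ((A + 1) ^ 3) ⟩
    27 * (A + 1) ^ 3       ≡⟨ ^-distribʳ-* 3 3 (A + 1) ⟨
    (3 * (A + 1)) ^ 3      ≤⟨ ^-monoˡ-≤ 3 step ⟩
    (4 * A) ^ 3            ≡⟨ ^-distribʳ-* 3 4 A ⟩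
    64 * A ^ 3             ≤⟨ *-monoˡ-≤ (A ^ 3) (m≤m+n 64 8) ⟩
    72 * A ^ 3             ≡⟨ rearr₂ (A ^ 3) ⟩
    3 * (3 * (8 * A ^ 3))  ∎)
... | no ob≰1 | _ = grows (cross (begin
  9 * 3 ^ ones a * (A + eval b) ^ 3
    ≤⟨ *-mono-≤ (*-monoˡ-≤ (3 ^ ones a) (^-monoʳ-≤ 3 (≰⇒> ob≰1)))
         (^-monoˡ-≤ 3 (≤-trans (+-monoʳ-≤ A B≤A) (≤-reflexive (cong (A +_) (sym (+-identityʳ A)))))) ⟩
  3 ^ ones b * 3 ^ ones a * (2 * A) ^ 3
    ≡⟨ cong₂ _*_ (trans (*-comm (3 ^ ones b) _) (sym (^-distribˡ-+-* 3 (ones a) (ones b))))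
         (^-distribʳ-* 3 2 A) ⟩
  3 ^ (ones a + ones b) * (8 * A ^ 3) ∎))
  where
  open ≤-Reasoning
  A : ℕ
  A = eval a

⊕-wlog : (P : Expr → Set) →
  (∀ {e e′} → eval e ≡ eval e′ → ones e ≡ ones e′ → P e → P e′) →
  ∀ a b → (eval b ≤ eval a → P (a ⊕ b)) → (eval a ≤ eval b → P (b ⊕ a)) → P (a ⊕ b)
⊕-wlog P resp a b p q with ≤-total (eval b) (eval a)
... | inj₁ le = p le
... | inj₂ le = resp {b ⊕ a} {a ⊕ b} (+-comm (eval b) (eval a)) (+-comm (ones b) (ones a)) (q le)

1⊛ : ∀ x → 1 // 1 ⊛ x ≈ x
1⊛ x = ≈-trans (⊛-comm (1 // 1) x) (⊛-identityʳ 1 x)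

-- This is nonnegativity of the defect. Products multiply values, and sums increase the value of the
-- larger summand except for 1 + 1 and 2 + 1, which `tiny` checks by hand.
1⊑fr : ∀ e → 1 // 1 ⊑ fr e
1⊑fr one = cross (s≤s z≤n)
1⊑fr (e ⊗ f) = ≲-trans (1⊑fr f) (≲-trans (proj₂ (1⊛ (fr f)))
  (≲-trans (⊛-monoˡ (fr f) (1⊑fr e)) (proj₂ (fr-⊗ e f))))
1⊑fr (a ⊕ b) = ⊕-wlog (λ e → 1 // 1 ⊑ fr e)
  (λ {e} {e′} v o p → ≲-trans p (proj₁ (fr-cong {e} {e′} o v))) a b
  (bound a b (1⊑fr a)) (bound b a (1⊑fr b))
  where
  bound : ∀ a b → 1 // 1 ⊑ fr a → eval b ≤ eval a → 1 // 1 ⊑ fr (a ⊕ b)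
  bound a b 1⊑a le with sumCase a b le
  ... | grows p = ≲-trans 1⊑a (≲-trans (proj₂ (1⊛ (fr a)))
    (≲-trans (⊛-monoˡ (fr a) (cross {1 // 1} {9 // 8} (m≤m+n 8 1))) p))
  ... | small refl A≤2 = cross (tiny (eval a) (ones a) A≤2 (>-nonZero⁻¹ _ {{ones≢0 a}})
          (_⊑_.uncross 1⊑a))
    where
    tiny : ∀ A o → A ≤ 2 → 1 ≤ o → 1 * A ^ 3 ≤ 3 ^ o * 1 → 1 * (A + 1) ^ 3 ≤ 3 ^ (o + 1) * 1
    tiny 0 o _ 1≤o _ = *-monoˡ-≤ 1 (m^n>0 3 (o + 1))
    tiny 1 o _ 1≤o _ = *-monoˡ-≤ 1 (≤-trans (m≤m+n 8 1) (^-monoʳ-≤ 3 {2} (+-monoˡ-≤ 1 1≤o)))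
    tiny 2 1 _ _ le = ⊥-elim (<⇒≱ (m≤m+n 4 4) le)
    tiny 2 (suc (suc o)) _ _ _ = *-monoˡ-≤ 1 (^-monoʳ-≤ 3 {3} (s≤s (s≤s (m≤n+m 1 o))))
    tiny (suc (suc (suc A))) o (s≤s (s≤s ())) _ _

frac-⊑-⊛ʳ : ∀ x {y} → 1 // 1 ⊑ y → x ⊑ x ⊛ y
frac-⊑-⊛ʳ x 1⊑y = ≲-trans (proj₂ (⊛-identityʳ 1 x)) (⊛-monoʳ x 1⊑y)

fr-⊑-⊗ˡ : ∀ e f → fr e ⊑ fr (e ⊗ f)
fr-⊑-⊗ˡ e f = ≲-trans (frac-⊑-⊛ʳ (fr e) (1⊑fr f)) (proj₂ (fr-⊗ e f))

fr-⊑-⊗ʳ : ∀ e f → fr f ⊑ fr (e ⊗ f)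
fr-⊑-⊗ʳ e f = ≲-trans (fr-⊑-⊗ˡ f e) (proj₁ (⊗-comm-fr f e))

-- A product has both factors below 9/8, and a growing sum has value at least 9/8, so the only
-- remaining building block is 2 + 1.
near-1⇒powerOf3 : ∀ e → fr e ≺ 9 // 8 → Triples e three
near-1⇒powerOf3 one lt = ⊥-elim (lt (cross (m≤m+n 9 15)))
near-1⇒powerOf3 (e ⊗ f) lt = triples-three-⊗
  (near-1⇒powerOf3 e (≲-≺-trans (fr-⊑-⊗ˡ e f) lt))
  (near-1⇒powerOf3 f (≲-≺-trans (fr-⊑-⊗ʳ e f) lt))
near-1⇒powerOf3 (a ⊕ b) = ⊕-wlog (λ e → fr e ≺ 9 // 8 → Triples e three)
  (λ {e} {e′} v o p lt → triples-resp {e} {e′} v o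
    (p (≲-≺-trans (proj₁ (fr-cong {e} {e′} o v)) lt)))
  a b (sums a b) (sums b a)
  where
  -- For A = 1 the sum has value at least 9/8. For A = 2 a single one is too few, two ones give
  -- `three`, and more give a value of at least 3.
  values : ∀ A o → A ≤ 2 → 1 ≤ A → 1 ≤ o → 1 * A ^ 3 ≤ 3 ^ o * 1 →
    3 ^ (o + 1) * 8 < 9 * (A + 1) ^ 3 → A + 1 ≡ 3 × o + 1 ≡ 3
  values 1 o _ _ 1≤o _ lt =
    ⊥-elim (<⇒≱ lt (*-monoˡ-≤ 8 (^-monoʳ-≤ 3 {2} (+-monoˡ-≤ 1 1≤o))))
  values 2 1 _ _ _ le _ = ⊥-elim (<⇒≱ (m≤m+n 4 4) le)
  values 2 2 _ _ _ _ _ = refl , refl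
  values 2 (suc (suc (suc o))) _ _ _ _ lt = ⊥-elim (<⇒≱ lt (≤-trans (m≤m+n 243 405)
    (*-monoˡ-≤ 8 (^-monoʳ-≤ 3 {4} (s≤s (s≤s (s≤s (m≤n+m 1 o))))))))
  values (suc (suc (suc A))) o (s≤s (s≤s ())) _ _ _ _

  sums : ∀ a b → eval b ≤ eval a → fr (a ⊕ b) ≺ 9 // 8 → Triples (a ⊕ b) three
  sums a b le lt with sumCase a b le
  ... | grows p = ⊥-elim (lt (≲-trans (frac-⊑-⊛ʳ (9 // 8) (1⊑fr a)) p))
  ... | small refl A≤2
    with v , o ← values (eval a) (ones a) A≤2 (>-nonZero⁻¹ _ {{eval≢0 a}})
      (>-nonZero⁻¹ _ {{ones≢0 a}}) (_⊑_.uncross (1⊑fr a)) (≺-uncross lt)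
    = triples-refl {a ⊕ one} {three} v o

-- Finite covers below the powers of 9/8

expressions : ℕ → List Expr
expressions zero = one ∷ []
expressions (suc n) = one ∷ cartesianProductWith _⊕_ (expressions n) (expressions n)
  ++ cartesianProductWith _⊗_ (expressions n) (expressions n)

∈-expressions : ∀ n e → ones e ≤ suc n → e ∈ expressions n
∈-expressions zero e le with refl ← ones≡1 e le = here refl
∈-expressions (suc n) one _ = here refl
∈-expressions (suc n) (e ⊕ f) le = there (∈-++⁺ˡ (∈-cartesianProductWith⁺ _⊕_
  (∈-expressions n e (s≤s⁻¹ (≤-trans (m<m+n (ones e) (>-nonZero⁻¹ _ {{ones≢0 f}})) le)))
  (∈-expressions n f (s≤s⁻¹ (≤-trans (m<n+m (ones f) (>-nonZero⁻¹ _ {{ones≢0 e}})) le)))))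
∈-expressions (suc n) (e ⊗ f) le = there (∈-++⁺ʳ
  (cartesianProductWith _⊕_ (expressions n) (expressions n)) (∈-cartesianProductWith⁺ _⊗_
  (∈-expressions n e (s≤s⁻¹ (≤-trans (m<m+n (ones e) (>-nonZero⁻¹ _ {{ones≢0 f}})) le)))
  (∈-expressions n f (s≤s⁻¹ (≤-trans (m<n+m (ones f) (>-nonZero⁻¹ _ {{ones≢0 e}})) le)))))

level : ℕ → Frac
level k = 9 ^ k // (8 ^ k)
  where instance _ = m^n≢0 8 k

constant : Expr → Family
constant e = 0 , leaf e , tt

product : Family → Family → Family
product (c , M , v) (d , N , w) = c + d , M ⊗ᴹ N , ⊗ᴹ-valid M N v w

extend : Family → Expr → Family
extend (d , M , v) b = suc d , extendᴹ b M , extend-valid b M v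

-- Below level k + 1, a non-growing sum has evaluation at most 3, and a growing one at most twice
-- its larger summand. The cubes 27 and 8 bound 3^ones of the whole sum, respectively of the smaller
-- summand, by 9^(k+1) · 27.
smallExpressions : ℕ → List Expr
smallExpressions k = expressions (9 ^ suc k * 27)

families : ℕ → List Family
families zero = []
families (suc k) = map constant (smallExpressions k)
  ++ cartesianProductWith product (families k) (families k)
  ++ cartesianProductWith extend (families k) (smallExpressions k)

Covered : ℕ → Expr → Set
Covered k e = ∃ λ f → Any (f ∈ᶠ_) (families k) × Triples e f

covered-small : ∀ k e → ones e ≤ 9 ^ suc k * 27 → Covered (suc k) e
covered-small k e le = e ,
  lose (∈-++⁺ˡ (∈-map⁺ constant (∈-expressions _ e (≤-trans le (n≤1+n _))))) ([] , refl) ,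
  triples-refl {e} {e} refl refl

covered-⊗ : ∀ k e f → Covered k e → Covered k f → Covered (suc k) (e ⊗ f)
covered-⊗ k e f (e′ , e∈ , t) (f′ , f∈ , t′)
  with (c , M , v) , M∈ , m , refl ← find e∈ | (d , N , w) , N∈ , n , refl ← find f∈
  = e′ ⊗ f′ ,
    lose (∈-++⁺ʳ (map constant (smallExpressions k))
      (∈-++⁺ˡ (∈-cartesianProductWith⁺ product M∈ N∈))) (m ++ᵛ n , at-⊗-++ M N m n) ,
    triples-⊗ t t′

covered-⊕ : ∀ k a b → ones b ≤ 9 ^ suc k * 27 → Covered k a → Covered (suc k) (a ⊕ b)
covered-⊕ k a b le (f , f∈ , t)
  with (d , M , v) , M∈ , m , refl ← find f∈
  = times3^ f (exponent t) ⊕ b ,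
    lose (∈-++⁺ʳ (map constant (smallExpressions k))
      (∈-++⁺ʳ (cartesianProductWith product (families k) (families k))
        (∈-cartesianProductWith⁺ extend M∈ (∈-expressions _ b (≤-trans le (n≤1+n _))))))
      (exponent t ∷ m , at-shift (exponent t) b M m) ,
    triples-⊕ b t

level-cancel : ∀ k x → 9 // 8 ⊛ x ≺ level (suc k) → x ≺ level k
level-cancel k x lt l⊑x = lt (⊛-monoʳ (9 // 8) l⊑x)

-- A factor below 9/8 is a power of three and is absorbed by `Triples`. Otherwise both factors, or
-- the larger summand of a growing sum, drop one level, and the smaller summand comes from a finite
-- list.
cover : ∀ k e → fr e ≺ level k → Covered k e
cover zero e lt = ⊥-elim (lt (1⊑fr e))
cover (suc k) one _ = covered-small k one (≤-trans (m^n>0 9 (suc k)) (m≤m*n _ 27))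
cover (suc k) (e ⊗ f) lt with 9 // 8 ≲? fr e | 9 // 8 ≲? fr f
... | no e≺ | _ with g , g∈ , t ← cover (suc k) f (≲-≺-trans (fr-⊑-⊗ʳ e f) lt) =
  g , g∈ , triples-three-⊗ (near-1⇒powerOf3 e e≺) t
... | yes _ | no f≺ with g , g∈ , t ← cover (suc k) e (≲-≺-trans (fr-⊑-⊗ˡ e f) lt) =
  g , g∈ , triples-resp {f ⊗ e} {e ⊗ f} (*-comm (eval f) (eval e)) (+-comm (ones f) (ones e))
    (triples-three-⊗ (near-1⇒powerOf3 f f≺) t)
... | yes e⊒ | yes f⊒ = covered-⊗ k e f
  (cover k e (level-cancel k (fr e) (≲-≺-trans (≲-trans (⊛-monoˡ (fr e) f⊒) (proj₂ (fr-⊗ f e)))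
    (≲-≺-trans (proj₁ (⊗-comm-fr f e)) lt))))
  (cover k f (level-cancel k (fr f) (≲-≺-trans (≲-trans (⊛-monoˡ (fr f) e⊒) (proj₂ (fr-⊗ e f))) lt)))
cover (suc k) (a ⊕ b) = ⊕-wlog (λ e → fr e ≺ level (suc k) → Covered (suc k) e)
  (λ {e} {e′} v o p lt → let (f , f∈ , t) = p (≲-≺-trans (proj₁ (fr-cong {e} {e′} o v)) lt) in
    f , f∈ , triples-resp {e} {e′} v o t)
  a b (sums a b (cover k a)) (sums b a (cover k b))
  where
  sums : ∀ a b → (fr a ≺ level k → Covered k a) → eval b ≤ eval a →
    fr (a ⊕ b) ≺ level (suc k) → Covered (suc k) (a ⊕ b)
  sums a b rec le lt with sumCase a b le
  ... | small refl A≤2 = covered-small k (a ⊕ one) (<⇒≤ (begin-strict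
    ones (a ⊕ one)              <⟨ n<3^n _ ⟩
    3 ^ ones (a ⊕ one)          ≤⟨ m≤m*n _ (8 ^ suc k) {{m^n≢0 8 (suc k)}} ⟩
    3 ^ ones (a ⊕ one) * 8 ^ suc k  ≤⟨ <⇒≤ (≺-uncross lt) ⟩
    9 ^ suc k * (eval a + 1) ^ 3  ≤⟨ *-monoʳ-≤ (9 ^ suc k) (^-monoˡ-≤ 3 (+-monoˡ-≤ 1 A≤2)) ⟩
    9 ^ suc k * 27              ∎))
    where open ≤-Reasoning
  ... | grows p = covered-⊕ k a b ones-b (rec (level-cancel k (fr a) (≲-≺-trans p lt)))
    where
    open ≤-Reasoning
    A : ℕ
    A = eval a
    rearr : ∀ p q → p * (8 * q) ≡ p * 8 * q
    rearr = solve-∀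
    A³≤ : A ^ 3 ≤ 3 ^ ones a
    A³≤ = subst₂ _≤_ (*-identityˡ (A ^ 3)) (*-identityʳ _) (_⊑_.uncross (1⊑fr a))
    -- The evaluation of the sum is at most 2A, and A³ is at most 3^(ones a) by `1⊑fr`, so the cost
    -- of `a` cancels.
    ones-b : ones b ≤ 9 ^ suc k * 27
    ones-b = <⇒≤ (<-≤-trans (n<3^n (ones b))
      (*-cancelˡ-≤ (3 ^ ones a) {{3^≢0 (ones a)}} (begin
        3 ^ ones a * 3 ^ ones b             ≡⟨ ^-distribˡ-+-* 3 (ones a) (ones b) ⟨
        3 ^ (ones a + ones b)               ≤⟨ m≤m*n _ (8 ^ suc k) {{m^n≢0 8 (suc k)}} ⟩
        3 ^ (ones a + ones b) * 8 ^ suc k   ≤⟨ <⇒≤ (≺-uncross lt) ⟩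
        9 ^ suc k * (A + eval b) ^ 3
          ≤⟨ *-monoʳ-≤ (9 ^ suc k) (^-monoˡ-≤ 3 (+-monoʳ-≤ A (≤-trans le (≤-reflexive (sym (+-identityʳ A)))))) ⟩
        9 ^ suc k * (2 * A) ^ 3             ≡⟨ cong (9 ^ suc k *_) (^-distribʳ-* 3 2 A) ⟩
        9 ^ suc k * (8 * A ^ 3)             ≤⟨ *-monoʳ-≤ (9 ^ suc k) (*-mono-≤ (m≤m+n 8 19) A³≤) ⟩
        9 ^ suc k * (27 * 3 ^ ones a)       ≡⟨ *-assoc (9 ^ suc k) 27 _ ⟨
        9 ^ suc k * 27 * 3 ^ ones a         ≡⟨ *-comm (9 ^ suc k * 27) _ ⟩
        3 ^ ones a * (9 ^ suc k * 27)       ∎)))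

-- By Bernoulli's inequality (9/8)^k is at least (8 + k) / 8, which exceeds `a` for k = 8a.
level-unbounded : ∀ x → ∃ λ k → x ≺ level k
level-unbounded (a // b) = k , ≺-cross (begin-strict
  a * 8 ^ k         ≤⟨ m≤m*n _ b ⟩
  a * 8 ^ k * b     <⟨ *-monoˡ-< b lt ⟩
  9 ^ k * b         ∎)
  where
  open ≤-Reasoning
  k : ℕ
  k = 8 * a
  bernoulli : ∀ k → (8 + k) * 8 ^ k ≤ 8 * 9 ^ k
  bernoulli zero = ≤-refl
  bernoulli (suc k) = begin
    (8 + suc k) * (8 * 8 ^ k)       ≤⟨ m≤m+n _ _ ⟩
    (8 + suc k) * (8 * 8 ^ k) + k * 8 ^ k  ≡⟨ lem k (8 ^ k) ⟩
    9 * ((8 + k) * 8 ^ k)           ≤⟨ *-monoʳ-≤ 9 (bernoulli k) ⟩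
    9 * (8 * 9 ^ k)                 ≡⟨ lem′ (9 ^ k) ⟩
    8 * (9 * 9 ^ k)                 ∎
    where
    lem : ∀ k x → (8 + (1 + k)) * (8 * x) + k * x ≡ 9 * ((8 + k) * x)
    lem = solve-∀
    lem′ : ∀ x → 9 * (8 * x) ≡ 8 * (9 * x)
    lem′ = solve-∀
  lt : a * 8 ^ k < 9 ^ k
  lt = *-cancelˡ-< 8 _ _ (begin-strict
    8 * (a * 8 ^ k)   ≡⟨ *-assoc 8 a _ ⟨
    k * 8 ^ k         <⟨ *-monoˡ-< (8 ^ k) {{m^n≢0 8 k}} (m<n+m k {8} (s≤s z≤n)) ⟩
    (8 + k) * 8 ^ k   ≤⟨ bernoulli k ⟩
    8 * 9 ^ k         ∎)

abstract
  covering : ∀ x → Σ (List Family) λ F →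
    ∀ e → fr e ⊑ x → ∃ λ f → Any (f ∈ᶠ_) F × Triples e f
  covering x = families k , λ e e⊑x → cover k e (≲-≺-trans e⊑x x≺k)
    where
    k : ℕ
    k = proj₁ (level-unbounded x)
    x≺k : x ≺ level k
    x≺k = proj₂ (level-unbounded x)

-- The ordered set of values

-- The adjoined bottom gets the value 0: it lies below all values, which are at least 1, and is
-- fixed by tripling.
⟦_⟧ : Maybe Expr → Frac
⟦ nothing ⟧ = 0 // 1
⟦ just e ⟧ = fr e

record _≤ᵛ_ (x y : Maybe Expr) : Set where
  constructor lift
  field unlift : ⟦ x ⟧ ⊑ ⟦ y ⟧
open _≤ᵛ_

valueOrder : TotalPreorder (Maybe Expr)
valueOrder = record
  { _≲_ = _≤ᵛ_
  ; ≲-trans = λ p q → lift (≲-trans (unlift p) (unlift q))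
  ; ≲-total = λ x y → [ inj₁ ∘ lift , inj₂ ∘ lift ]′ (≲-total ⟦ x ⟧ ⟦ y ⟧)
  ; _≲?_ = λ x y → map′ lift unlift (⟦ x ⟧ ≲? ⟦ y ⟧)
  }

module V = TotalPreorder valueOrder

lift-≈ : ∀ {x y} → ⟦ x ⟧ ≈ ⟦ y ⟧ → x V.≈ y
lift-≈ (p , q) = lift p , lift q

lift-≺ : ∀ {x y} → ⟦ x ⟧ ≺ ⟦ y ⟧ → x V.≺ y
lift-≺ x≺y = x≺y ∘ unlift

lower-≺ : ∀ {x y} → x V.≺ y → ⟦ x ⟧ ≺ ⟦ y ⟧
lower-≺ x≺y = x≺y ∘ lift

nothing-least : ∀ x → nothing V.≲ x
nothing-least x = lift (cross z≤n)

nothing≺just : ∀ e → nothing V.≺ just e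
nothing≺just e (lift (cross p)) =
  <⇒≱ (m^n>0 3 (ones e)) (subst (_≤ 0) (*-identityʳ (3 ^ ones e)) p)

Tᵛ : Maybe Expr → Maybe Expr
Tᵛ = Maybe.map T

⟦T⟧ : ∀ x → ⟦ Tᵛ x ⟧ ≈ triple ⟦ x ⟧
⟦T⟧ nothing = ≈-cross refl
⟦T⟧ (just e) = fr-T e

Tᵛ-mono : ∀ {x y} → x V.≲ y → Tᵛ x V.≲ Tᵛ y
Tᵛ-mono {x} {y} (lift p) = lift
  (≲-trans (proj₁ (⟦T⟧ x)) (≲-trans (⊛-monoˡ (3 // 1) p) (proj₂ (⟦T⟧ y))))

Tᵛ-cancel : ∀ {x y} → Tᵛ x V.≲ Tᵛ y → x V.≲ y
Tᵛ-cancel {x} {y} (lift p) = lift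
  (⊛-cancelʳ (3 // 1) (≲-trans (proj₂ (⟦T⟧ x)) (≲-trans p (proj₁ (⟦T⟧ y)))))

≺-triple : ∀ e → fr e ≺ triple (fr e)
≺-triple e (cross p) = <⇒≱ (m<m*n (3 ^ ones e) 3 {{3^≢0 (ones e)}} (s≤s (s≤s z≤n)))
  (*-cancelʳ-≤ (3 ^ ones e * 3) (3 ^ ones e) d
    (subst (λ x → 3 ^ ones e * 3 * d ≤ 3 ^ ones e * x) (*-identityʳ d) p))
  where
  d : ℕ
  d = eval e ^ 3
  instance _ = m^n≢0 (eval e) 3 {{eval≢0 e}}

three≲just : ∀ e → just three V.≲ just e
three≲just e = lift (≲-trans (cross ≤-refl) (1⊑fr e))

-- Successors, limit points and floors of values

least : ∀ x (L : List (Maybe Expr)) → ∃ λ s → s ∈ x ∷ L × All (s V.≲_) (x ∷ L)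
least x [] = x , here refl , V.≲-refl ∷ []
least x (y ∷ L) with least y L
... | s , s∈ , ps with V.≲-total x s
...   | inj₁ x≲s = x , here refl , V.≲-refl ∷ All.map (V.≲-trans x≲s) ps
...   | inj₂ s≲x = s , there s∈ , s≲x ∷ ps

greatest : ∀ x (L : List (Maybe Expr)) → ∃ λ s → s ∈ x ∷ L × All (V._≲ s) (x ∷ L)
greatest x [] = x , here refl , V.≲-refl ∷ []
greatest x (y ∷ L) with greatest y L
... | s , s∈ , ps with V.≲-total x s
...   | inj₁ x≲s = s , there s∈ , x≲s ∷ ps
...   | inj₂ s≲x = x , here refl , V.≲-refl ∷ All.map (λ p → V.≲-trans p s≲x) ps

-- `T e` is a value above `e`, so only values up to it compete. Finitely many families cover these,
-- and `Above` reduces them to finitely many candidates, whose least element is the successor.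
successor : ∀ x → ∃ λ s → x V.≺ s × (∀ {y} → x V.≺ y → s V.≲ y)
successor nothing = just three , nothing≺just three , λ {y} → least-nonbottom y
  where
  least-nonbottom : ∀ y → nothing V.≺ y → just three V.≲ y
  least-nonbottom nothing lt = ⊥-elim (lt V.≲-refl)
  least-nonbottom (just e) _ = three≲just e
successor (just e) = s , lift-≺ {just e} {s} (All.lookup candidates≻ (proj₁ (proj₂ smallest))) ,
  λ {y} → least-above y
  where
  F : List Family
  F = proj₁ (covering (fr (T e)))
  A : Above (fr e) (λ f → Any (f ∈ᶠ_) F)
  A = families-above F (fr e)
  candidates : List (Maybe Expr)
  candidates = map just (Above.bounds A)
  candidates≻ : All (λ x → fr e ≺ ⟦ x ⟧) (just (T e) ∷ candidates)
  candidates≻ = ≺-≲-trans {fr e} {triple (fr e)} {fr (T e)} (≺-triple e) (proj₂ (fr-T e))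
    ∷ All.map⁺ (Above.above A)
  smallest : ∃ λ s → s ∈ just (T e) ∷ candidates × All (s V.≲_) (just (T e) ∷ candidates)
  smallest = least (just (T e)) candidates
  s : Maybe Expr
  s = proj₁ smallest
  s≲ : All (s V.≲_) (just (T e) ∷ candidates)
  s≲ = proj₂ (proj₂ smallest)
  via : ∀ f → fr e ≺ fr f → (∃ λ g → Any (g ∈ᶠ_) F × Triples f g) → s V.≲ just f
  via f e≺f (g , g∈ , t) =
    let l , l∈ , l⊑g = find (Above.minimal A g∈
          (≺-≲-trans {fr e} {fr f} {fr g} e≺f (proj₁ (triples-fr t))))
    in V.≲-trans {s} {just l} {just f} (All.lookup s≲ (there (∈-map⁺ just l∈)))
      (lift (≲-trans {fr l} {fr g} {fr f} l⊑g (proj₂ (triples-fr t))))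
  least-above : ∀ y → just e V.≺ y → s V.≲ y
  least-above nothing lt = ⊥-elim (lt (nothing-least _))
  least-above (just f) e≺f = [ (λ Te⊑f → V.≲-trans {s} {just (T e)} {just f} (All.lookup s≲ (here refl)) (lift Te⊑f))
    , (λ f⊑Te → via f (lower-≺ {just e} {just f} e≺f) (proj₂ (covering (fr (T e))) f f⊑Te))
    ]′ (≲-total (fr (T e)) (fr f))

-- h · 3ⁱ + 1 costs one more than h · 3ⁱ, so its value tends to T h from below.
Tᵛ-limit : ∀ {y} h → y V.≺ Tᵛ h → ∃ λ z → y V.≺ z × z V.≺ Tᵛ h
Tᵛ-limit {y} nothing lt = ⊥-elim (lt (nothing-least y))
Tᵛ-limit {y} (just e) lt = just z , lift-≺ {y} {just z} y≺z ,
    lift-≺ {just z} {just (T e)} (≺-≲-trans {fr z} {triple (fr e)} {fr (T e)} (Approx.upper approx) (proj₂ (fr-T e)))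
  where
  stretched : ∃ λ N → ∀ n → N ≤ n → ⟦ y ⟧ ⊛ stretch n 1 ≺ triple (fr e)
  stretched = stretch-small {⟦ y ⟧} {triple (fr e)} 1
    (≺-≲-trans {⟦ y ⟧} {fr (T e)} {triple (fr e)} (lower-≺ {y} {just (T e)} lt) (proj₁ (fr-T e)))
  N : ℕ
  N = proj₁ stretched
  z : Expr
  z = times3^ e N ⊕ one
  approx : Approx 1 N z e
  approx = Approx-fresh N e one
  y≺z : ⟦ y ⟧ ≺ fr z
  y≺z z⊑y = proj₂ stretched N ≤-refl (≲-trans {triple (fr e)} {fr z ⊛ stretch N 1}
    (Approx.lower approx) (⊛-monoˡ (stretch N 1) z⊑y))

-- Applying `Tᵛ-limit` repeatedly climbs past each of the finitely many entries of `L` below `T h`.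
Tᵛ-limit-avoiding : ∀ (L : List Expr) {y} h → y V.≺ Tᵛ h →
  ∃ λ z → y V.≺ z × z V.≺ Tᵛ h × All (λ f → just f V.≺ Tᵛ h → just f V.≺ z) L
Tᵛ-limit-avoiding [] h lt with Tᵛ-limit h lt
... | z , y≺z , z≺Th = z , y≺z , z≺Th , []
Tᵛ-limit-avoiding (f ∷ L) {y} h lt with Tᵛ-limit-avoiding L h lt
... | z , y≺z , z≺Th , avoid with Tᵛ h V.≲? just f
...   | yes Th≲f = z , y≺z , z≺Th , (λ f≺ → ⊥-elim (f≺ Th≲f)) ∷ avoid
...   | no f≺Th with V.≲-total z (just f)
...     | inj₂ f≲z with w , z≺w , w≺Th ← Tᵛ-limit h z≺Th =
  w , V.≺-≲-trans y≺z (V.≺⇒≲ z≺w) , w≺Th ,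
  (λ _ → V.≲-≺-trans f≲z z≺w) ∷ All.map (λ a lt → V.≺-≲-trans (a lt) (V.≺⇒≲ z≺w)) avoid
...     | inj₁ z≲f with w , f≺w , w≺Th ← Tᵛ-limit h f≺Th =
  w , V.≺-≲-trans y≺z (V.≲-trans z≲f (V.≺⇒≲ f≺w)) , w≺Th ,
  (λ _ → f≺w) ∷ All.map (λ a lt → V.≺-≲-trans (a lt) (V.≲-trans z≲f (V.≺⇒≲ f≺w))) avoid

boxesAt : ∀ x → Boxes ⟦ x ⟧ (λ e → Any (e ∈ᶠ_) (proj₁ (covering ⟦ x ⟧)))
boxesAt x = families-boxes (proj₁ (covering ⟦ x ⟧)) ⟦ x ⟧

locate : ∀ x e → just e V.≲ x → ∃ λ f → Triples e f ×
  (f ∈ Boxes.points (boxesAt x) ⊎ ∃ λ v → v ∈ Boxes.limits (boxesAt x) × fr e ≺ triple (fr v))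
locate x e (lift e⊑x) = f , t , [ inj₁ , inj₂ ∘ limit ]′ (Boxes.covered (boxesAt x) (proj₁ (proj₂ found))
    (≲-trans {fr f} {fr e} {⟦ x ⟧} (proj₂ (triples-fr t)) e⊑x))
  where
  found : ∃ λ f → Any (f ∈ᶠ_) (proj₁ (covering ⟦ x ⟧)) × Triples e f
  found = proj₂ (covering ⟦ x ⟧) e e⊑x
  f : Expr
  f = proj₁ found
  t : Triples e f
  t = proj₂ (proj₂ found)
  limit : ∀ {L} → Any (λ v → fr f ≺ triple (fr v)) L → ∃ λ v → v ∈ L × fr e ≺ triple (fr v)
  limit q = let v , v∈ , lt = find q in
    v , v∈ , ≲-≺-trans {fr e} {fr f} {triple (fr v)} (proj₁ (triples-fr t)) lt

-- `nothing` is the answer when no limit is listed.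
floorᵛ : Maybe Expr → Maybe Expr
floorᵛ x = proj₁ (greatest nothing (map just (Boxes.limits (boxesAt x))))

limit≲floorᵛ : ∀ x {v} → v ∈ Boxes.limits (boxesAt x) → just v V.≲ floorᵛ x
limit≲floorᵛ x v∈ =
  All.lookup (proj₂ (proj₂ (greatest nothing (map just (Boxes.limits (boxesAt x))))))
    (there (∈-map⁺ just v∈))

≺limit⇒≺T-floorᵛ : ∀ x {v e} → v ∈ Boxes.limits (boxesAt x) →
  fr e ≺ triple (fr v) → just e V.≺ Tᵛ (floorᵛ x)
≺limit⇒≺T-floorᵛ x {v} {e} v∈ lt = V.≺-≲-trans
  (lift-≺ {just e} {just (T v)} (≺-≲-trans lt (proj₂ (fr-T v)))) (Tᵛ-mono (limit≲floorᵛ x v∈))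

T-floorᵛ : ∀ x → Tᵛ (floorᵛ x) V.≲ x
T-floorᵛ x = All.lookup all (proj₁ (proj₂ (greatest nothing (map just (Boxes.limits (boxesAt x))))))
  where
  all : All (λ p → Tᵛ p V.≲ x) (nothing ∷ map just (Boxes.limits (boxesAt x)))
  all = nothing-least x ∷ All.map⁺ (All.map (λ {v} p → lift (≲-trans (proj₁ (fr-T v)) p))
    (Boxes.limits⊑ (boxesAt x)))

-- Otherwise some z between `T (floor x)` and `T h` avoids all listed points. Being at most `x`, it
-- is equivalent to a listed point or lies below a listed limit, hence below `T (floor x)`; both are
-- impossible.
floorᵛ-greatest : ∀ {h x} → Tᵛ h V.≲ x → h V.≲ floorᵛ x
floorᵛ-greatest {h} {x} Th≲x = decidable-stable (h V.≲? floorᵛ x) λ p≺h →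
  let z , Tp≺z , z≺Th , avoid = Tᵛ-limit-avoiding (Boxes.points (boxesAt x))
        {Tᵛ (floorᵛ x)} h (p≺h ∘ Tᵛ-cancel {h} {floorᵛ x})
  in absurd z Tp≺z z≺Th avoid
  where
  module _ (e : Expr) (Tp≺e : Tᵛ (floorᵛ x) V.≺ just e) (e≺Th : just e V.≺ Tᵛ h)
    (avoid : All (λ f → just f V.≺ Tᵛ h → just f V.≺ just e) (Boxes.points (boxesAt x)))
    where
    contradictory : (∃ λ f → Triples e f ×
      (f ∈ Boxes.points (boxesAt x) ⊎ ∃ λ v → v ∈ Boxes.limits (boxesAt x) × fr e ≺ triple (fr v))) → ⊥
    contradictory (f , t , inj₂ (v , v∈ , lt)) =
      Tp≺e (V.≺⇒≲ {just e} (≺limit⇒≺T-floorᵛ x v∈ lt))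
    contradictory (f , t , inj₁ f∈) = All.lookup avoid f∈
      (V.≲-≺-trans {just f} {just e} {Tᵛ h} (lift (proj₂ (triples-fr t))) e≺Th) (lift (proj₁ (triples-fr t)))

  absurd : ∀ z → Tᵛ (floorᵛ x) V.≺ z → z V.≺ Tᵛ h →
    All (λ f → just f V.≺ Tᵛ h → just f V.≺ z) (Boxes.points (boxesAt x)) → ⊥
  absurd nothing Tp≺z _ _ = Tp≺z (nothing-least _)
  absurd (just e) Tp≺z z≺Th avoid = contradictory e Tp≺z z≺Th avoid
    (locate x e (V.≲-trans {just e} {Tᵛ h} {x} (V.≺⇒≲ {just e} {Tᵛ h} z≺Th) Th≲x))

-- An element from `T (floor x)` on is below no listed limit, so only the listed points and the
-- bottom remain.
finite-above-floorᵛ : ∀ x → Σ (List (Maybe Expr)) λ L →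
  ∀ y → Tᵛ (floorᵛ x) V.≲ y → y V.≲ x → Any (y V.≈_) L
finite-above-floorᵛ x = nothing ∷ map just (Boxes.points (boxesAt x)) , cov
  where
  hit : ∀ e → Tᵛ (floorᵛ x) V.≲ just e → (∃ λ f → Triples e f ×
      (f ∈ Boxes.points (boxesAt x) ⊎ ∃ λ v → v ∈ Boxes.limits (boxesAt x) × fr e ≺ triple (fr v))) →
    Any (just e V.≈_) (nothing ∷ map just (Boxes.points (boxesAt x)))
  hit e _ (f , t , inj₁ f∈) = there (lose (∈-map⁺ just f∈) (lift-≈ {just e} {just f} (triples-fr t)))
  hit e Tp≲e (f , t , inj₂ (v , v∈ , lt)) = ⊥-elim (≺limit⇒≺T-floorᵛ x v∈ lt Tp≲e)
  cov : ∀ y → Tᵛ (floorᵛ x) V.≲ y → y V.≲ x →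
    Any (y V.≈_) (nothing ∷ map just (Boxes.points (boxesAt x)))
  cov nothing _ _ = here V.≈-refl
  cov (just e) Tp≲e e≲x = hit e Tp≲e (locate x e e≲x)

valueLimitOrder : LimitOrder valueOrder
valueLimitOrder = record
  { bottom = nothing
  ; bottom-least = nothing-least
  ; T = Tᵛ
  ; T-mono = Tᵛ-mono
  ; T-cancel = Tᵛ-cancel
  ; T-bottom = V.≲-refl
  ; unit = just three
  ; bottom≺unit = nothing≺just three
  ; below-unit = λ { {nothing} _ → V.≲-refl ; {just e} lt → ⊥-elim (lt (three≲just e)) }
  ; succ = λ x → proj₁ (successor x)
  ; x≺succ = λ x → proj₁ (proj₂ (successor x))
  ; succ-least = λ {x} → proj₂ (proj₂ (successor x))
  ; T-limit = λ {y} {h} → Tᵛ-limit {y} h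
  ; floor = floorᵛ
  ; T-floor = T-floorᵛ
  ; floor-greatest = floorᵛ-greatest
  ; finite = finite-above-floorᵛ
  }

-- Defects of positive integers

open Rank valueLimitOrder

eval-pad : ∀ c e → eval (pad c e) ≡ eval e
eval-pad zero e = refl
eval-pad (suc c) e = trans (*-identityʳ _) (eval-pad c e)

ones-pad : ∀ c e → ones (pad c e) ≡ ones e + c
ones-pad zero e = sym (+-identityʳ _)
ones-pad (suc c) e = trans (cong (_+ 1) (ones-pad c e)) (trans (+-assoc (ones e) c 1)
  (cong (ones e +_) (+-comm c 1)))

module Optimal (cpx : ℕ → ℕ) (spec : IsComplexityFn cpx) where

  optimal : ℕ → Expr
  optimal i = proj₁ (proj₁ (spec (suc i) (s≤s z≤n)))

  eval-optimal : ∀ i → eval (optimal i) ≡ suc i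
  eval-optimal i = proj₁ (proj₂ (proj₁ (spec (suc i) (s≤s z≤n))))

  ones-optimal : ∀ i → ones (optimal i) ≡ cpx (suc i)
  ones-optimal i = proj₂ (proj₂ (proj₁ (spec (suc i) (s≤s z≤n))))

  cpx-minimal : ∀ e → cpx (eval e) ≤ ones e
  cpx-minimal e = proj₂ (spec (eval e) (>-nonZero⁻¹ (eval e) {{eval≢0 e}})) e refl

  value : ℕ → Maybe Expr
  value i = just (optimal i)

  optimal-of : ∀ e → ∃ λ i → eval (optimal i) ≡ eval e × ones (optimal i) ≡ cpx (eval e)
  optimal-of e = i , trans (eval-optimal i) eq , trans (ones-optimal i) (cong cpx eq)
    where
    i : ℕ
    i = pred (eval e)
    eq : suc i ≡ eval e
    eq = suc-pred (eval e) {{eval≢0 e}}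

  optimal-or-T : ∀ e → (∃ λ i → fr (optimal i) ≈ fr e) ⊎ ∃ λ h → fr e ≈ fr (T h)
  optimal-or-T e = split (optimal-of e) (m≤n⇒m<n∨m≡n (cpx-minimal e))
    where
    split : (∃ λ i → eval (optimal i) ≡ eval e × ones (optimal i) ≡ cpx (eval e)) →
      cpx (eval e) < ones e ⊎ cpx (eval e) ≡ ones e →
      (∃ λ i → fr (optimal i) ≈ fr e) ⊎ ∃ λ h → fr e ≈ fr (T h)
    split (i , v , o) (inj₂ c≡o) = inj₁ (i , fr-cong {optimal i} {e} (trans o c≡o) v)
    split (i , v , o) (inj₁ c<o) = inj₂ (h , fr-cong {e} {T h} ones≡ (sym eval≡))
      where
      d : ℕ
      d = ones e ∸ suc (cpx (eval e))
      h : Expr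
      h = pad d (optimal i)
      eval≡ : eval (T h) ≡ eval e
      eval≡ = trans (*-identityʳ _) (trans (eval-pad d (optimal i)) v)
      ones≡ : ones e ≡ ones h + 1
      ones≡ = begin
        ones e                          ≡⟨ m+[n∸m]≡n c<o ⟨
        suc (cpx (eval e)) + d          ≡⟨ cong (λ x → suc x + d) o ⟨
        suc (ones (optimal i) + d)      ≡⟨ cong suc (ones-pad d (optimal i)) ⟨
        suc (ones h)                    ≡⟨ +-comm 1 (ones h) ⟩
        ones h + 1                      ∎
        where open ≡-Reasoning

  isolated⇒optimal : ∀ x → nothing V.≺ x → (∀ h → ¬ (x V.≈ Tᵛ h)) → ∃ λ i → value i V.≈ x
  isolated⇒optimal nothing lt _ = ⊥-elim (lt V.≲-refl)
  isolated⇒optimal (just e) _ isolated =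
    [ (λ { (i , eq) → i , lift-≈ {value i} {just e} eq })
    , (λ { (h , eq) → ⊥-elim (isolated (just h) (lift-≈ {just e} {just (T h)} eq)) })
    ]′ (optimal-or-T e)

  -- A cheaper expression for `eval f`, multiplied by 3^j at cost 3j, would beat the optimal
  -- expression for `suc i`.
  triples-optimal : ∀ i f → Triples (optimal i) f → ones f ≡ cpx (eval f)
  triples-optimal i f t = ≤-antisym (bound (optimal-of f)) (cpx-minimal f)
    where
    j : ℕ
    j = Triples.exponent t
    bound : (∃ λ l → eval (optimal l) ≡ eval f × ones (optimal l) ≡ cpx (eval f)) →
      ones f ≤ cpx (eval f)
    bound (l , v , o) = +-cancelʳ-≤ (3 * j) (ones f) (cpx (eval f)) (begin
      ones f + 3 * j          ≡⟨ triples-ones {optimal i} {f} t ⟨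
      ones (optimal i)               ≡⟨ ones-optimal i ⟩
      cpx (suc i)                    ≡⟨ cong cpx (eval-optimal i) ⟨
      cpx (eval (optimal i))         ≡⟨ cong cpx (trans (triples-eval {optimal i} {f} t)
                                          (trans (cong (_* 3 ^ j) (sym v))
                                            (sym (eval-times3^ (optimal l) j)))) ⟩
      cpx (eval (times3^ (optimal l) j))  ≤⟨ cpx-minimal (times3^ (optimal l) j) ⟩
      ones (times3^ (optimal l) j)        ≡⟨ ones-times3^ (optimal l) j ⟩
      ones (optimal l) + 3 * j            ≡⟨ cong (_+ 3 * j) o ⟩
      cpx (eval f) + 3 * j    ∎)
      where open ≤-Reasoning

  -- The search over all integers becomes finite: stripping powers of three from an optimal
  -- expression keeps it optimal and leads to a listed point of `T p`. Being listed under a limit is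
  -- excluded, since such values lie below `T (floor x)`.
  T-optimal? : ∀ p → Dec (∃ λ i → value i V.≈ Tᵛ p)
  T-optimal? p = map′ found search
    (any? (λ f → (just f V.≈? x) ×-dec (ones f ≟ cpx (eval f))) (Boxes.points (boxesAt x)))
    where
    x : Maybe Expr
    x = Tᵛ p
    Hit : Expr → Set
    Hit f = just f V.≈ x × ones f ≡ cpx (eval f)
    found : Any Hit (Boxes.points (boxesAt x)) → ∃ λ i → value i V.≈ x
    found hit = let f , _ , f≈x , o = find hit
                    i , v , o′ = optimal-of f
      in i , V.≈-trans {value i} {just f} {x}
        (lift-≈ {value i} {just f} (fr-cong {optimal i} {f} (trans o′ (sym o)) v)) f≈x
    search : (∃ λ i → value i V.≈ x) → Any Hit (Boxes.points (boxesAt x))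
    search (i , i≈x) = go (locate x (optimal i) (proj₁ i≈x))
      where
      go : (∃ λ f → Triples (optimal i) f × (f ∈ Boxes.points (boxesAt x) ⊎
        ∃ λ v → v ∈ Boxes.limits (boxesAt x) × fr (optimal i) ≺ triple (fr v))) →
        Any Hit (Boxes.points (boxesAt x))
      go (f , t , inj₁ f∈) = lose f∈
        (V.≈-trans {just f} {value i} {x} (V.≈-sym (lift-≈ {value i} {just f} (triples-fr t))) i≈x ,
         triples-optimal i f t)
      go (f , t , inj₂ (v , v∈ , lt)) = ⊥-elim (≺limit⇒≺T-floorᵛ x v∈ lt
        (V.≲-trans {Tᵛ (floorᵛ x)} {x} {value i} (T-floorᵛ x) (proj₂ i≈x)))

  open Restricted value (nothing≺just ∘ optimal) isolated⇒optimal T-optimal? public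

  cross-values : ∀ i j → Frac.num ⟦ value i ⟧ * Frac.den ⟦ value j ⟧ ≡ 3 ^ cpx (suc i) * suc j ^ 3
  cross-values i j = cong₂ (λ o v → 3 ^ o * v ^ 3) (ones-optimal i) (eval-optimal j)

  DefectLt⇒≺ : ∀ i j → DefectLt cpx i j → value i V.≺ value j
  DefectLt⇒≺ i j lt = lift-≺ {value i} {value j}
    (≺-cross (subst₂ _<_ (sym (cross-values i j)) (sym (cross-values j i)) lt))

  ≺⇒DefectLt : ∀ i j → value i V.≺ value j → DefectLt cpx i j
  ≺⇒DefectLt i j lt = subst₂ _<_ (cross-values i j) (cross-values j i)
    (≺-uncross (lower-≺ {value i} {value j} lt))

  -- Links the abstract bound `tower k` to the defect bound k, which exponentiates to 3^k.
  tower-value : ∀ k → ⟦ tower k ⟧ ≈ powerOf3 k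
  tower-value zero = ≈-cross refl
  tower-value (suc k) = ≈-trans (⟦T⟧ (tower k)) (≈-trans (⊛-congˡ (3 // 1) (tower-value k))
    (⊛-comm (powerOf3 k) (3 // 1)))

  below-cross : ∀ k i → 3 ^ cpx (suc i) < 3 ^ k * (suc i ^ 3) ⇔ (fr (optimal i) ≺ powerOf3 k)
  below-cross k i = mk⇔
    (λ lt → ≺-cross (subst₂ _<_ (sym left) (sym right) lt))
    (λ lt → subst₂ _<_ left right (≺-uncross lt))
    where
    left : 3 ^ ones (optimal i) * 1 ≡ 3 ^ cpx (suc i)
    left = trans (*-identityʳ _) (cong (3 ^_) (ones-optimal i))
    right : 3 ^ k * eval (optimal i) ^ 3 ≡ 3 ^ k * suc i ^ 3
    right = cong (λ v → 3 ^ k * v ^ 3) (eval-optimal i)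

  DefectBelow⇒Below : ∀ k i → DefectBelow cpx k i → Below k (value i)
  DefectBelow⇒Below k i b = lift-≺ {value i} {tower k}
    (≺-≲-trans (Equivalence.to (below-cross k i) b) (proj₂ (tower-value k)))

  Below⇒DefectBelow : ∀ k i → Below k (value i) → DefectBelow cpx k i
  Below⇒DefectBelow k i b = Equivalence.from (below-cross k i)
    (≺-≲-trans (lower-≺ {value i} {tower k} b) (proj₁ (tower-value k)))

  DefectBelow-mono : ∀ {k l} i → k ≤ l → DefectBelow cpx k i → DefectBelow cpx l i
  DefectBelow-mono i k≤l b = <-≤-trans b (*-monoˡ-≤ (suc i ^ 3) (^-monoʳ-≤ 3 k≤l))

  -- The defect of n is at most its complexity, which provides a bound to work under for each
  -- integer.
  DefectBelow-cpx : ∀ i → DefectBelow cpx (suc (cpx (suc i))) i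
  DefectBelow-cpx i = <-≤-trans (^-monoʳ-< 3 (s≤s (s≤s z≤n)) (n<1+n (cpx (suc i))))
    (m≤m*n _ (suc i ^ 3) {{m^n≢0 (suc i) 3}})

  defect-iso : ∀ k → OrderIso cpx (DefectBelow cpx (suc k)) (Vec ℕ (suc k)) LexLt
  defect-iso k = rankₒ k ,
    (λ i j bi bj → mk⇔
      (λ lt → rankₒ-mono k {i} {j} (DefectBelow⇒Below (suc k) j bj) (DefectLt⇒≺ i j lt))
      (λ lt → ≺⇒DefectLt i j (rankₒ-reflects k {i} {j} (DefectBelow⇒Below (suc k) i bi) lt))) ,
    λ v → hits v (rankₒ-surjective k v)
    where
    hits : ∀ v → (∃ λ i → Below (suc k) (value i) × rankₒ k i ≡ v) →
      ∃ λ i → DefectBelow cpx (suc k) i × rankₒ k i ≡ v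
    hits v (i , b , eq) = i , Below⇒DefectBelow (suc k) i b , eq

  -- Everything below `i` stays under the same defect bound, so a single vector length serves the
  -- whole descent.
  defect-wellFounded : WellFounded (DefectLt cpx)
  defect-wellFounded i = go (LexLt-wellFounded _ (rankₒ k i)) refl (DefectBelow-cpx i)
    where
    k : ℕ
    k = cpx (suc i)
    go : ∀ {v j} → Acc LexLt v → rankₒ k j ≡ v → DefectBelow cpx (suc k) j → Acc (DefectLt cpx) j
    go {j = j} (acc r) refl b = acc λ {l} l<j → go
      (r (rankₒ-mono k {l} {j} (DefectBelow⇒Below (suc k) j b) (DefectLt⇒≺ l j l<j))) refl
      (Below⇒DefectBelow (suc k) l (Below-≲ (suc k)
        (V.≺⇒≲ {value l} {value j} (DefectLt⇒≺ l j l<j)) (DefectBelow⇒Below (suc k) j b)))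

-- Gluing the ranks into ω^ω

strip : ∀ {m} → Vec ℕ m → CNF
strip [] = 0 , [] , tt
strip (zero ∷ v) = strip v
strip v@(suc _ ∷ _) = _ , v , _

strip-length : ∀ {m} (v : Vec ℕ m) → proj₁ (strip v) ≤ m
strip-length [] = z≤n
strip-length (zero ∷ v) = m≤n⇒m≤1+n (strip-length v)
strip-length (suc _ ∷ v) = ≤-refl

-- Common leading zeros disappear together. If only the smaller vector starts with zero, stripping
-- makes it strictly shorter.
strip-mono : ∀ {m} {v w : Vec ℕ m} → LexLt v w → strip v <ω strip w
strip-mono {w = suc b ∷ w} (here {a = zero} {v = v} _) = len< (s≤s (strip-length v))
strip-mono {w = suc b ∷ w} (here {a = suc a} lt) = lex< (here lt)
strip-mono (there {a = zero} lt) = strip-mono lt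
strip-mono (there {a = suc a} lt) = lex< (there lt)

strip-canonical : ∀ (x : CNF) → strip (proj₁ (proj₂ x)) ≡ x
strip-canonical (0 , [] , _) = refl
strip-canonical (suc m , zero ∷ v , p) = ⊥-elim (NonZero.nonZero p)
strip-canonical (suc m , suc a ∷ v , p) = refl

<ω-irrefl : ∀ {x} → ¬ (x <ω x)
<ω-irrefl (len< m<m) = <-irrefl refl m<m
<ω-irrefl (lex< v<v) = LexLt-irrefl v<v

<ω-asym : ∀ {x y} → x <ω y → ¬ (y <ω x)
<ω-asym (len< p) (len< q) = <-asym p q
<ω-asym (len< p) (lex< _) = <-irrefl refl p
<ω-asym (lex< _) (len< q) = <-irrefl refl q
<ω-asym (lex< p) (lex< q) = LexLt-asym p q

module All-defects (cpx : ℕ → ℕ) (spec : IsComplexityFn cpx) where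
  open Optimal cpx spec

  -- The complexity serves as a sufficiently large bound; any other one only changes the number of
  -- leading zeros, which `strip` removes.
  rankω : ℕ → CNF
  rankω i = strip (rankₒ (cpx (suc i)) i)

  strip-rankₒ : ∀ {k l} i → k ≤ l → DefectBelow cpx (suc k) i →
    strip (rankₒ l i) ≡ strip (rankₒ k i)
  strip-rankₒ {k} i k≤l b = go (≤⇒≤′ k≤l)
    where
    go : ∀ {l} → k ≤′ l → strip (rankₒ l i) ≡ strip (rankₒ k i)
    go ≤′-refl = refl
    go (≤′-step {l} p) = trans
      (cong strip (rankₒ-suc l {i} (DefectBelow⇒Below (suc l) i
        (DefectBelow-mono i (s≤s (≤′⇒≤ p)) b)))) (go p)

  rankω-at : ∀ k i → DefectBelow cpx (suc k) i → rankω i ≡ strip (rankₒ k i)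
  rankω-at k i b = trans (sym (strip-rankₒ i (m≤m⊔n c k) (DefectBelow-cpx i)))
    (strip-rankₒ i (m≤n⊔m c k) b)
    where
    c : ℕ
    c = cpx (suc i)

  -- Two integers are compared under the larger of their bounds, where both ranks are vectors of one
  -- length.
  rankω-common : ∀ i j → ∃ λ k → rankω i ≡ strip (rankₒ k i) × rankω j ≡ strip (rankₒ k j)
    × DefectBelow cpx (suc k) j
  rankω-common i j = k , rankω-at k i bi , rankω-at k j bj , bj
    where
    k : ℕ
    k = cpx (suc i) ⊔ cpx (suc j)
    bi : DefectBelow cpx (suc k) i
    bi = DefectBelow-mono i (s≤s (m≤m⊔n (cpx (suc i)) (cpx (suc j)))) (DefectBelow-cpx i)
    bj : DefectBelow cpx (suc k) j
    bj = DefectBelow-mono j (s≤s (m≤n⊔m (cpx (suc i)) (cpx (suc j)))) (DefectBelow-cpx j)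

  rankω-mono : ∀ i j → value i V.≺ value j → rankω i <ω rankω j
  rankω-mono i j lt = let k , eqi , eqj , bj = rankω-common i j in
    subst₂ _<ω_ (sym eqi) (sym eqj)
      (strip-mono (rankₒ-mono k {i} {j} (DefectBelow⇒Below (suc k) j bj) lt))

  rankω-cong : ∀ i j → value i V.≈ value j → rankω i ≡ rankω j
  rankω-cong i j eq = let k , eqi , eqj , _ = rankω-common i j in
    trans eqi (trans (cong strip (rankₒ-cong k {i} {j} eq)) (sym eqj))

  rankω-reflects : ∀ i j → rankω i <ω rankω j → value i V.≺ value j
  rankω-reflects i j lt vj≲vi =
    [ (λ vj≺vi → <ω-asym lt (rankω-mono j i vj≺vi))
    , (λ vj≈vi → <ω-irrefl (subst (rankω i <ω_) (rankω-cong j i vj≈vi) lt))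
    ]′ (V.≺-or-≈ vj≲vi)

  rankω-hits : ∀ {k} (v : Vec ℕ (suc k)) → ∃ λ i → rankω i ≡ strip v
  rankω-hits {k} v = hits (rankₒ-surjective k v)
    where
    hits : (∃ λ i → Below (suc k) (value i) × rankₒ k i ≡ v) → ∃ λ i → rankω i ≡ strip v
    hits (i , b , eq) = i , trans (rankω-at k i (Below⇒DefectBelow (suc k) i b)) (cong strip eq)

  rankω-surjective : ∀ x → ∃ λ i → rankω i ≡ x
  -- `rankₒ` always has at least one digit, so the empty normal form is reached from the single
  -- digit 0.
  rankω-surjective (0 , [] , _) = rankω-hits (0 ∷ [])
  rankω-surjective x@(suc m , v , p) =
    let i , eq = rankω-hits v in i , trans eq (strip-canonical x)

theorem1p2 : (cpx : ℕ → ℕ) → IsComplexityFn cpx →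
    WellFounded (DefectLt cpx) ×
    OrderIso cpx AllPos CNF _<ω_ ×
    (∀ (k : ℕ) → 1 ≤ k →
    OrderIso cpx (DefectBelow cpx k) (Vec ℕ k) LexLt)
theorem1p2 cpx spec = defect-wellFounded ,
  (rankω ,
    (λ i j _ _ → mk⇔ (λ lt → rankω-mono i j (DefectLt⇒≺ i j lt))
      (λ lt → ≺⇒DefectLt i j (rankω-reflects i j lt))) ,
    λ x → let i , eq = rankω-surjective x in i , tt , eq) ,
  λ { (suc k) _ → defect-iso k }
  where
  open Optimal cpx spec
  open All-defects cpx spec
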